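{- Let $n\ge 2$, $k\ge 1$, $M_1\in\mathbb N^+$ and $\mathbf C=(c_0,\dots,c_k)\in\{0,1\}^{k+1}$, and let $\gamma$ be Euler's constant. Let $P(O_{\mathbf C}(n,m+c_k-1))=O_{\mathbf C}(n,m+c_k-1)/n!^k$. (i) If $c_0=0$ and $M=\left\lceil ekc_1(\log(n-1)+\gamma)+\frac{e\pi^2}{6}\sum_{\beta=2}^k c_\beta\binom{k}{\beta}\right\rceil+M_1$, then $$\sum_{m=M+1}^{n}P(O_{\mathbf C}(n,m+c_k-1))\le \exp(-M_1).$$ (ii) If $c_0=1$ and $M'=\left\lceil ekc'_1(\log(n-1)+\gamma)+\frac{e\pi^2}{6}\sum_{\beta=2}^k c'_\beta\binom{k}{\beta}\right\rceil+M_1$, then $$\sum_{1\le m< n+1-M'}P(O_{\mathbf C}(n,m+c_k-1))\le \exp(-M_1).$$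
   Context: Fix integers $k\ge 1$, $n\ge 1$ and $\mathbf C=(c_0,\dots,c_k)\in\{0,1\}^{k+1}$; put $\mathbf C'=(1,\dots,1)-\mathbf C=(c'_0,\dots,c'_k)$. Consider $k$-tuples $(\pi_1,\dots,\pi_k)$ of permutations of $\{1,\dots,n\}$ (there are $n!^k$). A position $\alpha$ is a record of a permutation $\pi$ if $\pi(\alpha)<\pi(\alpha')$ for every $\alpha'<\alpha$ (position $1$ is always a record); equivalently records index the minimal elements of the points $(\alpha,\pi(\alpha))$ under strict componentwise domination. For a tuple, let $l_\alpha$ be the number of $\beta\in\{1,\dots,k\}$ for which $\alpha$ is a record of $\pi_\beta$. The $\mathbf C$ sequential optimization set of the tuple is $S=\{\alpha:c_{l_\alpha}=1\}$, with weight $|S|$. For an integer $m$, $O_{\mathbf C}(n,m)$ is the number of $k$-tuples whose weight equals $m$. Thus $\sum_{m>M}P(O_{\mathbf C}(n,m+c_k-1))$ is the probability that a uniformly random $k$-tuple has weight $>M+c_k-1$. $\log$ is the natural logarithm. -}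

module Defs where

open import Data.Nat.Base as ℕ using (ℕ; zero; suc; z≤n; s≤s; _!)
import Data.Nat.Properties as ℕ
open import Data.Nat.Properties using (_!≢0)
open import Data.Nat.Combinatorics using (_C_)
open import Data.Integer.Base as ℤ using (ℤ; +_; -[1+_]; +0; +[1+_])
import Data.Integer.Properties as ℤ
import Data.Integer.Solver as ℤ-Solver
open import Data.Rational
  using (ℚ; mkℚ; _+_; _*_; _-_; -_; _≤_; _<_; _/_; 1/_; ∣_∣; 0ℚ; 1ℚ; ½;
         toℚᵘ; fromℚᵘ; NonZero; NonNegative; Positive;
         positive; nonNegative; *<*; *≤*)
open import Data.Rational.Properties
import Data.Rational.Unnormalised.Base as ℚᵘ
import Data.Rational.Unnormalised.Properties as ℚᵘ
open import Data.Rational.Solver using (module +-*-Solver)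
open import Data.Fin.Base as Fin using (Fin; zero; suc; toℕ; fromℕ; fromℕ<; opposite)
import Data.Fin.Properties as Fin
open import Data.Fin.Subset using (Subset) renaming (∣_∣ to card)
open import Data.List.Base as List using (List; []; _∷_; filter; length; allFin)
open import Data.Nat.ListAction using (sum)
open import Data.Vec.Base as Vec using (Vec; []; _∷_; lookup; tabulate; count)
open import Data.Vec.Properties using (count≤n)
open import Data.Vec.Relation.Unary.Unique.Propositional using (Unique)
import Data.Vec.Relation.Unary.AllPairs as AllPairs
open import Data.Product.Base using (∃; _×_; _,_; proj₁; proj₂)
open import Data.Sum.Base using (inj₁; inj₂)
open import Relation.Nullary.Decidable using (Dec; does; ¬?; _→-dec_)
open import Relation.Binary.PropositionalEquality

------------------------------------------------------------------------
-- Rational arithmetic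

open +-*-Solver

infixl 6 _⊕_
_⊕_ : ∀ {p q r s} → p ≤ q → r ≤ s → p + r ≤ q + s
_⊕_ = +-mono-≤

cast : ∀ {p q p′ q′ : ℚ} → p ≡ p′ → q ≡ q′ → p ≤ q → p′ ≤ q′
cast refl refl h = h

*-pos : ∀ {p q} → 0ℚ < p → 0ℚ < q → 0ℚ < p * q
*-pos {p} {q} hp hq =
  positive⁻¹ (p * q) {{pos*pos⇒pos p {{positive hp}} q {{positive hq}}}}

*-nonNeg : ∀ {p q} → 0ℚ ≤ p → 0ℚ ≤ q → 0ℚ ≤ p * q
*-nonNeg {p} {q} hp hq = nonNegative⁻¹ (p * q)
  {{nonNeg*nonNeg⇒nonNeg p {{nonNegative hp}} q {{nonNegative hq}}}}

*-monoˡ : ∀ {r p q} → 0ℚ ≤ r → p ≤ q → r * p ≤ r * q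
*-monoˡ {r} hr = *-monoˡ-≤-nonNeg r {{nonNegative hr}}

*-monoʳ : ∀ {r p q} → 0ℚ ≤ r → p ≤ q → p * r ≤ q * r
*-monoʳ {r} hr = *-monoʳ-≤-nonNeg r {{nonNegative hr}}

*-mono : ∀ {p q r s} → 0ℚ ≤ p → 0ℚ ≤ s → p ≤ q → r ≤ s → p * r ≤ q * s
*-mono hp hs pq rs = ≤-trans (*-monoˡ hp rs) (*-monoʳ hs pq)

0<½ : 0ℚ < ½
0<½ = positive⁻¹ ½

0≤1 : 0ℚ ≤ 1ℚ
0≤1 = nonNegative⁻¹ 1ℚ

half : ℚ → ℚ
half p = ½ * p

half-pos : ∀ {p} → 0ℚ < p → 0ℚ < half p
half-pos = *-pos 0<½

half+half : ∀ p → half p + half p ≡ p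
half+half = solve 1 (λ e → con ½ :* e :+ con ½ :* e := e) refl

p≤p+q : ∀ {p q} → 0ℚ ≤ q → p ≤ p + q
p≤p+q {p} hq = cast (+-identityʳ p) refl (≤-refl {p} ⊕ hq)

p≤∣p∣ : ∀ p → p ≤ ∣ p ∣
p≤∣p∣ p with ≤-total 0ℚ p
... | inj₁ h = ≤-reflexive (sym (0≤p⇒∣p∣≡p h))
... | inj₂ h = ≤-trans h (0≤∣p∣ p)

-p≤∣p∣ : ∀ p → - p ≤ ∣ p ∣
-p≤∣p∣ p = subst (- p ≤_) (∣-p∣≡∣p∣ p) (p≤∣p∣ (- p))

∣p∣≤ : ∀ {p c} → p ≤ c → - p ≤ c → ∣ p ∣ ≤ c
∣p∣≤ {p} h h′ with ∣p∣≡p∨∣p∣≡-p p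
... | inj₁ e = subst (_≤ _) (sym e) h
... | inj₂ e = subst (_≤ _) (sym e) h′

close⇒≤ : ∀ {p q ε} → ∣ p - q ∣ ≤ ε → p ≤ q + ε
close⇒≤ {p} {q} h = cast
  (solve 2 (λ p q → q :+ (p :- q) := p) refl p q) refl
  (≤-refl {q} ⊕ ≤-trans (p≤∣p∣ (p - q)) h)

≤⇒close : ∀ {p q ε} → p ≤ q + ε → q ≤ p + ε → ∣ p - q ∣ ≤ ε
≤⇒close {p} {q} {ε} h h′ = ∣p∣≤
  (cast refl (solve 2 (λ q e → q :+ e :- q := e) refl q ε) (h ⊕ ≤-refl { - q}))
  (cast (solve 2 (λ p q → q :- p := :- (p :- q)) refl p q)
        (solve 2 (λ q e → q :+ e :- q := e) refl p ε) (h′ ⊕ ≤-refl { - p}))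

toℚᵘ-/ : ∀ i b → toℚᵘ (i / suc b) ℚᵘ.≃ ℚᵘ.mkℚᵘ i b
toℚᵘ-/ i b = toℚᵘ-fromℚᵘ (ℚᵘ.mkℚᵘ i b)

frac-≤ : ∀ {a b c d} → a ℕ.* suc d ℕ.≤ c ℕ.* suc b → + a / suc b ≤ + c / suc d
frac-≤ {a} {b} {c} {d} h = toℚᵘ-cancel-≤
  (ℚᵘ.≤-respˡ-≃ (ℚᵘ.≃-sym (toℚᵘ-/ (+ a) b))
  (ℚᵘ.≤-respʳ-≃ (ℚᵘ.≃-sym (toℚᵘ-/ (+ c) d))
  (ℚᵘ.*≤* (subst₂ ℤ._≤_ (ℤ.pos-* a (suc d)) (ℤ.pos-* c (suc b)) (ℤ.+≤+ h)))))

frac-≡ : ∀ {a b c d} → a ℕ.* suc d ≡ c ℕ.* suc b → + a / suc b ≡ + c / suc d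
frac-≡ {a} {b} {c} {d} e = ≤-antisym
  (frac-≤ {a} {b} {c} {d} (ℕ.≤-reflexive e)) (frac-≤ {c} {d} {a} {b} (ℕ.≤-reflexive (sym e)))

frac-+ : ∀ a c b → + a / suc b + + c / suc b ≡ + (a ℕ.+ c) / suc b
frac-+ a c b = toℚᵘ-injective
  (ℚᵘ.≃-trans (toℚᵘ-homo-+ (+ a / suc b) (+ c / suc b))
  (ℚᵘ.≃-trans (ℚᵘ.+-cong (toℚᵘ-/ (+ a) b) (toℚᵘ-/ (+ c) b))
  (ℚᵘ.≃-trans (ℚᵘ.*≡* (lem (+ a) (+ c) (+ suc b)))
  (ℚᵘ.≃-sym (toℚᵘ-/ (+ (a ℕ.+ c)) b)))))
  where
  open ℤ-Solver.+-*-Solver renaming (solve to solveℤ; _:+_ to _∔_; _:*_ to _∗_; _:=_ to _≔_)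
  lem : ∀ x y z → (x ℤ.* z ℤ.+ y ℤ.* z) ℤ.* z ≡ (x ℤ.+ y) ℤ.* (z ℤ.* z)
  lem = solveℤ 3 (λ x y z → (x ∗ z ∔ y ∗ z) ∗ z ≔ (x ∔ y) ∗ (z ∗ z)) refl

frac-* : ∀ a c b d → (+ a / suc b) * (+ c / suc d) ≡ + (a ℕ.* c) / (suc b ℕ.* suc d)
frac-* a c b d = toℚᵘ-injective
  (ℚᵘ.≃-trans (toℚᵘ-homo-* (+ a / suc b) (+ c / suc d))
  (ℚᵘ.≃-trans (ℚᵘ.*-cong (toℚᵘ-/ (+ a) b) (toℚᵘ-/ (+ c) d))
  (ℚᵘ.≃-trans (ℚᵘ.*≡* (cong (ℤ._* + (suc b ℕ.* suc d)) (sym (ℤ.pos-* a c))))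
  (ℚᵘ.≃-sym (toℚᵘ-/ (+ (a ℕ.* c)) _)))))

frac-nonNeg : ∀ a b → 0ℚ ≤ + a / suc b
frac-nonNeg a b = frac-≤ {0} {0} {a} {b} z≤n

-- The reciprocal, extended by recip 0 = 0.
recip : ℚ → ℚ
recip (mkℚ +0 _ _)           = 0ℚ
recip p@(mkℚ +[1+ _ ] _ _)   = 1/ p
recip p@(mkℚ -[1+ _ ] _ _)   = 1/ p

*-recip : ∀ {p} → 0ℚ < p → p * recip p ≡ 1ℚ
*-recip {mkℚ +0 _ _}         (*<* (ℤ.+<+ ()))
*-recip {p@(mkℚ +[1+ _ ] _ _)} h = *-inverseʳ p
*-recip {mkℚ -[1+ _ ] _ _}   (*<* ())

recip-nonNeg : ∀ {p} → 0ℚ < p → 0ℚ ≤ recip p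
recip-nonNeg {mkℚ +0 _ _}         (*<* (ℤ.+<+ ()))
recip-nonNeg {p@(mkℚ +[1+ _ ] _ _)} h = <⇒≤ (positive⁻¹ (1/ p) {{1/pos⇒pos p}})
recip-nonNeg {mkℚ -[1+ _ ] _ _}   (*<* ())

recip-pos : ∀ {p} → 0ℚ < p → 0ℚ < recip p
recip-pos {mkℚ +0 _ _}         (*<* (ℤ.+<+ ()))
recip-pos {p@(mkℚ +[1+ _ ] _ _)} h = positive⁻¹ (1/ p) {{1/pos⇒pos p}}
recip-pos {mkℚ -[1+ _ ] _ _}   (*<* ())

recip-anti : ∀ {p q} → 0ℚ < p → p ≤ q → recip q ≤ recip p
recip-anti {p} {q} hp pq = cast eq₁ eq₂
  (*-monoʳ (recip-nonNeg hp) (*-monoˡ (recip-nonNeg hq) pq))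
  where
  hq = <-≤-trans hp pq
  eq₁ : recip q * p * recip p ≡ recip q
  eq₁ = trans (*-assoc (recip q) p (recip p))
       (trans (cong (recip q *_) (*-recip hp)) (*-identityʳ _))
  eq₂ : recip q * q * recip p ≡ recip p
  eq₂ = trans (cong (_* recip p) (trans (*-comm (recip q) q) (*-recip hq))) (*-identityˡ _)

recip-unique : ∀ {p q} → 0ℚ < p → p * q ≡ 1ℚ → recip p ≡ q
recip-unique {p} {q} hp e = begin
  recip p             ≡⟨ sym (*-identityʳ _) ⟩
  recip p * 1ℚ        ≡⟨ cong (recip p *_) (sym e) ⟩
  recip p * (p * q)   ≡⟨ solve 3 (λ r p q → r :* (p :* q) := p :* r :* q) refl (recip p) p q ⟩
  p * recip p * q     ≡⟨ cong (_* q) (*-recip hp) ⟩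
  1ℚ * q              ≡⟨ *-identityˡ q ⟩
  q                   ∎
  where open ≡-Reasoning

archimedes : ∀ {ε} → 0ℚ < ε → ∃ λ N → ∀ n → N ℕ.≤ n → + 1 / suc n ≤ ε
archimedes {mkℚ +0 _ _}       (*<* (ℤ.+<+ ()))
archimedes {mkℚ -[1+ _ ] _ _} (*<* ())
archimedes {p@(mkℚ +[1+ a ] d _)} _ = d , λ n d≤n →
  subst (+ 1 / suc n ≤_) (↥p/↧p≡p p)
    (frac-≤ {1} {n} {suc a} {d}
      (ℕ.≤-trans (ℕ.≤-reflexive (ℕ.*-identityˡ (suc d)))
      (ℕ.≤-trans (s≤s d≤n) (ℕ.m≤m+n (suc n) (a ℕ.* suc n)))))

archimedes* : ∀ {c ε} → 0ℚ ≤ c → 0ℚ < ε →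
              ∃ λ N → ∀ n → N ℕ.≤ n → c * (+ 1 / suc n) ≤ ε
archimedes* {c} {ε} hc hε = proj₁ A , λ n N≤n → ≤-trans
  (*-mono hc (<⇒≤ δ-pos) (p≤p+q 0≤1) (proj₂ A n N≤n)) (≤-reflexive eq)
  where
  c+1-pos : 0ℚ < c + 1ℚ
  c+1-pos = subst (_< c + 1ℚ) (+-identityʳ 0ℚ) (+-mono-≤-< hc (positive⁻¹ 1ℚ))
  δ-pos : 0ℚ < recip (c + 1ℚ) * ε
  δ-pos = *-pos (recip-pos c+1-pos) hε
  A = archimedes δ-pos
  eq : (c + 1ℚ) * (recip (c + 1ℚ) * ε) ≡ ε
  eq = trans (sym (*-assoc (c + 1ℚ) _ ε))
      (trans (cong (_* ε) (*-recip c+1-pos)) (*-identityˡ ε))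

-- Σ< n f = f 0 + … + f (n - 1)
Σ< : ℕ → (ℕ → ℚ) → ℚ
Σ< zero    f = 0ℚ
Σ< (suc n) f = Σ< n f + f n

Σ-mono : ∀ n {f g} → (∀ i → i ℕ.< n → f i ≤ g i) → Σ< n f ≤ Σ< n g
Σ-mono zero    h = ≤-refl
Σ-mono (suc n) h = Σ-mono n (λ i i<n → h i (ℕ.m<n⇒m<1+n i<n)) ⊕ h n ℕ.≤-refl

Σ-cong : ∀ n {f g} → (∀ i → f i ≡ g i) → Σ< n f ≡ Σ< n g
Σ-cong zero    h = refl
Σ-cong (suc n) h = cong₂ _+_ (Σ-cong n h) (h n)

Σ-split : ∀ m n f → Σ< (m ℕ.+ n) f ≡ Σ< m f + Σ< n (λ j → f (m ℕ.+ j))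
Σ-split m zero    f rewrite ℕ.+-identityʳ m = sym (+-identityʳ _)
Σ-split m (suc n) f rewrite ℕ.+-suc m n =
  trans (cong (_+ f (m ℕ.+ n)) (Σ-split m n f))
        (+-assoc (Σ< m f) (Σ< n (λ j → f (m ℕ.+ j))) (f (m ℕ.+ n)))

Σ-block-suc : ∀ m t f → Σ< (suc m ℕ.* t) f ≡ Σ< (m ℕ.* t) f + Σ< t (λ j → f (m ℕ.* t ℕ.+ j))
Σ-block-suc m t f = trans (cong (λ l → Σ< l f) (ℕ.+-comm t (m ℕ.* t))) (Σ-split (m ℕ.* t) t f)

Σ-block : ∀ m t f → Σ< (m ℕ.* t) f ≡ Σ< m (λ i → Σ< t (λ j → f (i ℕ.* t ℕ.+ j)))
Σ-block zero    t f = refl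
Σ-block (suc m) t f =
  trans (Σ-block-suc m t f) (cong (_+ Σ< t (λ j → f (m ℕ.* t ℕ.+ j))) (Σ-block m t f))

Σ-shift : ∀ n g → Σ< n (λ i → g (suc i)) + g 0 ≡ Σ< n g + g n
Σ-shift zero    g = refl
Σ-shift (suc n) g =
  trans (solve 3 (λ x y z → x :+ y :+ z := x :+ z :+ y) refl (Σ< n _) (g (suc n)) (g 0))
        (cong (_+ g (suc n)) (Σ-shift n g))

Σ-const : ∀ t b c → Σ< t (λ _ → (+ 1 / suc b) * c) ≡ (+ t / suc b) * c
Σ-const zero    b c = sym (trans (cong (_* c) (0/n≡0 (suc b))) (*-zeroˡ c))
Σ-const (suc t) b c = begin
  Σ< t (λ _ → (+ 1 / suc b) * c) + (+ 1 / suc b) * c  ≡⟨ cong (_+ _) (Σ-const t b c) ⟩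
  (+ t / suc b) * c + (+ 1 / suc b) * c               ≡⟨ sym (*-distribʳ-+ c (+ t / suc b) _) ⟩
  (+ t / suc b + + 1 / suc b) * c                     ≡⟨ cong (_* c) (frac-+ t 1 b) ⟩
  (+ (t ℕ.+ 1) / suc b) * c                           ≡⟨ cong (λ l → (+ l / suc b) * c) (ℕ.+-comm t 1) ⟩
  (+ suc t / suc b) * c                               ∎
  where open ≡-Reasoning

------------------------------------------------------------------------
-- Real numbers, as Cauchy sequences of rationals

IsCauchy : (ℕ → ℚ) → Set
IsCauchy s = ∀ ε → 0ℚ < ε → ∃ λ N → ∀ m n → N ℕ.≤ m → N ℕ.≤ n → ∣ s m - s n ∣ ≤ ε

record ℝ : Set where
  constructor mkℝ
  field
    seq    : ℕ → ℚ
    cauchy : IsCauchy seq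

open ℝ public

infix  4 _≤ℝ_ _<ℝ_
infixl 6 _+ℝ_ _-ℝ_
infixl 7 _*ℝ_

_≤ℝ_ : ℝ → ℝ → Set
x ≤ℝ y = ∀ ε → 0ℚ < ε → ∃ λ N → ∀ n → N ℕ.≤ n → seq x n ≤ seq y n + ε

_<ℝ_ : ℝ → ℝ → Set
x <ℝ y = ∃ λ ε → 0ℚ < ε × ∃ λ N → ∀ n → N ℕ.≤ n → seq x n + ε ≤ seq y n

≤⇒cauchy : ∀ {s} → (∀ ε → 0ℚ < ε → ∃ λ N → ∀ m n → N ℕ.≤ m → N ℕ.≤ n → s m ≤ s n + ε) →
           IsCauchy s
≤⇒cauchy h ε hε with h ε hε
... | N , b = N , λ m n Nm Nn → ≤⇒close (b m n Nm Nn) (b n m Nn Nm)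

⊔-left : ∀ {a b n} → a ℕ.⊔ b ℕ.≤ n → a ℕ.≤ n
⊔-left {a} {b} = ℕ.≤-trans (ℕ.m≤m⊔n a b)

⊔-right : ∀ {a b n} → a ℕ.⊔ b ℕ.≤ n → b ℕ.≤ n
⊔-right {a} {b} = ℕ.≤-trans (ℕ.m≤n⊔m a b)

+-cauchy : ∀ x y → IsCauchy (λ n → seq x n + seq y n)
+-cauchy x y = ≤⇒cauchy {λ n → seq x n + seq y n} λ ε hε →
  let (M , f) = cauchy x (half ε) (half-pos hε)
      (N , g) = cauchy y (half ε) (half-pos hε)
  in M ℕ.⊔ N , λ m n hm hn → cast refl
       (trans (solve 3 (λ a b e → a :+ e :+ (b :+ e) := a :+ b :+ (e :+ e)) refl
                 (seq x n) (seq y n) (half ε))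
              (cong (_+_ (seq x n + seq y n)) (half+half ε)))
       (close⇒≤ {seq x m} {seq x n} (f m n (⊔-left hm) (⊔-left hn))
         ⊕ close⇒≤ {seq y m} {seq y n} (g m n (⊔-right {M} hm) (⊔-right {M} hn)))

neg-cauchy : ∀ x → IsCauchy (λ n → - seq x n)
neg-cauchy x ε hε with cauchy x ε hε
... | N , f = N , λ m n hm hn → subst (λ z → ∣ z ∣ ≤ ε)
  (solve 2 (λ a b → b :- a := :- a :- :- b) refl (seq x m) (seq x n)) (f n m hn hm)

bounded : ∀ x → ∃ λ N → ∃ λ B → 0ℚ < B × (∀ n → N ℕ.≤ n → ∣ seq x n ∣ ≤ B)
bounded x with cauchy x 1ℚ (positive⁻¹ 1ℚ)
... | N , f = N , ∣ seq x N ∣ + 1ℚ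
            , subst (_< ∣ seq x N ∣ + 1ℚ) (+-identityʳ 0ℚ)
                (+-mono-≤-< (0≤∣p∣ (seq x N)) (positive⁻¹ 1ℚ))
            , λ n h → ≤-trans
                (≤-reflexive (cong ∣_∣ (solve 2 (λ a b → a := b :+ (a :- b)) refl (seq x n) (seq x N))))
                (≤-trans (∣p+q∣≤∣p∣+∣q∣ (seq x N) (seq x n - seq x N))
                         (≤-refl {∣ seq x N ∣} ⊕ f n N h ℕ.≤-refl))

*-close : ∀ {A B ε} xm xn ym yn → 0ℚ < A → 0ℚ < B → 0ℚ < ε → ∣ xm ∣ ≤ A → ∣ yn ∣ ≤ B →
          ∣ xm - xn ∣ ≤ recip B * half ε → ∣ ym - yn ∣ ≤ recip A * half ε →
          ∣ xm * ym - xn * yn ∣ ≤ ε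
*-close {A} {B} {ε} xm xn ym yn A-pos B-pos hε hA hB dx dy = begin
  ∣ xm * ym - xn * yn ∣
    ≡⟨ cong ∣_∣ (solve 4 (λ a b c d → a :* c :- b :* d := a :* (c :- d) :+ d :* (a :- b))
                   refl xm xn ym yn) ⟩
  ∣ xm * (ym - yn) + yn * (xm - xn) ∣
    ≤⟨ ∣p+q∣≤∣p∣+∣q∣ (xm * (ym - yn)) (yn * (xm - xn)) ⟩
  ∣ xm * (ym - yn) ∣ + ∣ yn * (xm - xn) ∣
    ≡⟨ cong₂ _+_ (∣p*q∣≡∣p∣*∣q∣ xm (ym - yn)) (∣p*q∣≡∣p∣*∣q∣ yn (xm - xn)) ⟩
  ∣ xm ∣ * ∣ ym - yn ∣ + ∣ yn ∣ * ∣ xm - xn ∣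
    ≤⟨ *-mono (0≤∣p∣ xm) (δ-nonneg A-pos) hA dy ⊕ *-mono (0≤∣p∣ yn) (δ-nonneg B-pos) hB dx ⟩
  A * (recip A * half ε) + B * (recip B * half ε)
    ≡⟨ cong₂ _+_ (cancel A-pos) (cancel B-pos) ⟩
  half ε + half ε
    ≡⟨ half+half ε ⟩
  ε ∎
  where
  open ≤-Reasoning
  δ-nonneg : ∀ {c} → 0ℚ < c → 0ℚ ≤ recip c * half ε
  δ-nonneg hc = <⇒≤ (*-pos (recip-pos hc) (half-pos hε))
  cancel : ∀ {c} → 0ℚ < c → c * (recip c * half ε) ≡ half ε
  cancel {c} hc = trans (sym (*-assoc c (recip c) (half ε)))
                 (trans (cong (_* half ε) (*-recip hc)) (*-identityˡ (half ε)))

*-cauchy : ∀ x y → IsCauchy (λ n → seq x n * seq y n)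
*-cauchy x y ε hε = combine (bounded x) (bounded y)
  where
  combine : (∃ λ N → ∃ λ A → 0ℚ < A × (∀ n → N ℕ.≤ n → ∣ seq x n ∣ ≤ A)) →
            (∃ λ N → ∃ λ B → 0ℚ < B × (∀ n → N ℕ.≤ n → ∣ seq y n ∣ ≤ B)) →
            ∃ λ N → ∀ m n → N ℕ.≤ m → N ℕ.≤ n → ∣ seq x m * seq y m - seq x n * seq y n ∣ ≤ ε
  combine (N₁ , A , A-pos , hA) (N₂ , B , B-pos , hB) =
    combine′ (cauchy x _ (*-pos (recip-pos B-pos) (half-pos hε)))
             (cauchy y _ (*-pos (recip-pos A-pos) (half-pos hε)))
    where
    combine′ : (∃ λ N → ∀ m n → N ℕ.≤ m → N ℕ.≤ n → ∣ seq x m - seq x n ∣ ≤ recip B * half ε) →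
               (∃ λ N → ∀ m n → N ℕ.≤ m → N ℕ.≤ n → ∣ seq y m - seq y n ∣ ≤ recip A * half ε) →
               ∃ λ N → ∀ m n → N ℕ.≤ m → N ℕ.≤ n → ∣ seq x m * seq y m - seq x n * seq y n ∣ ≤ ε
    combine′ (M , f) (N , g) = (N₁ ℕ.⊔ N₂) ℕ.⊔ (M ℕ.⊔ N) , λ m n hm hn →
      *-close (seq x m) (seq x n) (seq y m) (seq y n) A-pos B-pos hε
        (hA m (⊔-left {N₁} {N₂} (⊔-left {N₁ ℕ.⊔ N₂} hm)))
        (hB n (⊔-right {N₁} {N₂} (⊔-left {N₁ ℕ.⊔ N₂} hn)))
        (f m n (⊔-left {M} {N} (⊔-right {N₁ ℕ.⊔ N₂} hm)) (⊔-left {M} {N} (⊔-right {N₁ ℕ.⊔ N₂} hn)))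
        (g m n (⊔-right {M} {N} (⊔-right {N₁ ℕ.⊔ N₂} hm)) (⊔-right {M} {N} (⊔-right {N₁ ℕ.⊔ N₂} hn)))

fromℚ : ℚ → ℝ
fromℚ q = mkℝ (λ _ → q) (≤⇒cauchy {λ _ → q} λ ε hε → 0 , λ _ _ _ _ → p≤p+q {q} (<⇒≤ hε))

fromℤ : ℤ → ℝ
fromℤ z = fromℚ (z / 1)

fromℕᴿ : ℕ → ℝ
fromℕᴿ n = fromℤ (+ n)

_+ℝ_ : ℝ → ℝ → ℝ
x +ℝ y = mkℝ (λ n → seq x n + seq y n) (+-cauchy x y)

-ℝ_ : ℝ → ℝ
-ℝ x = mkℝ (λ n → - seq x n) (neg-cauchy x)

_-ℝ_ : ℝ → ℝ → ℝ
x -ℝ y = x +ℝ (-ℝ y)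

_*ℝ_ : ℝ → ℝ → ℝ
x *ℝ y = mkℝ (λ n → seq x n * seq y n) (*-cauchy x y)

-- ∣ a m - a n ∣ ≤ ε for all m, n ≥ N; one inequality is enough because m and n
-- are interchangeable.
IsCauchyℝ : (ℕ → ℝ) → Set
IsCauchyℝ a = ∀ ε → 0ℚ < ε → ∃ λ N → ∀ m n → N ℕ.≤ m → N ℕ.≤ n → a m ≤ℝ a n +ℝ fromℚ ε

diagonal : (ℕ → ℝ) → ℕ → ℕ
diagonal a k = proj₁ (cauchy (a k) (+ 1 / suc k) (positive⁻¹ _ {{normalize-pos 1 (suc k)}}))

diagonal-close : ∀ a k n → diagonal a k ℕ.≤ n → ∣ seq (a k) (diagonal a k) - seq (a k) n ∣ ≤ + 1 / suc k
diagonal-close a k n h =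
  proj₂ (cauchy (a k) (+ 1 / suc k) (positive⁻¹ _ {{normalize-pos 1 (suc k)}})) _ n ℕ.≤-refl h

diagonal-close′ : ∀ a k n → diagonal a k ℕ.≤ n → ∣ seq (a k) n - seq (a k) (diagonal a k) ∣ ≤ + 1 / suc k
diagonal-close′ a k n h =
  proj₂ (cauchy (a k) (+ 1 / suc k) (positive⁻¹ _ {{normalize-pos 1 (suc k)}})) n _ h ℕ.≤-refl

-- The limit of a Cauchy sequence of reals: its k-th term is a term of a k that
-- lies within 1/(k+1) of all later terms of a k.
lim : (a : ℕ → ℝ) → IsCauchyℝ a → ℝ
lim a h = mkℝ (λ k → seq (a k) (diagonal a k)) (≤⇒cauchy {λ k → seq (a k) (diagonal a k)} λ ε hε →
  let δ = half (half ε)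
      hδ = half-pos (half-pos hε)
      (M , f) = h δ hδ
      (N , g) = archimedes hδ
  in M ℕ.⊔ N , λ k l hk hl →
    let (J , j) = f k l (⊔-left hk) (⊔-left hl) δ hδ
        n = J ℕ.⊔ (diagonal a k ℕ.⊔ diagonal a l)
        nk = ⊔-left (⊔-right {J} {n = n} ℕ.≤-refl)
        nl = ⊔-right {diagonal a k} (⊔-right {J} {n = n} ℕ.≤-refl)
        s₁ = ≤-trans (close⇒≤ {seq (a k) (diagonal a k)} {seq (a k) n} (diagonal-close a k n nk))
                     (≤-refl {seq (a k) n} ⊕ g k (⊔-right {M} hk))
        s₂ = j n (⊔-left ℕ.≤-refl)
        s₃ = ≤-trans (close⇒≤ {seq (a l) n} {seq (a l) (diagonal a l)} (diagonal-close′ a l n nl))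
                     (≤-refl {seq (a l) (diagonal a l)} ⊕ g l (⊔-right {M} hl))
        y = seq (a l) (diagonal a l)
    in ≤-trans s₁ (≤-trans (s₂ ⊕ ≤-refl {δ})
       (cast refl (solve 2 (λ y e → let d = con ½ :* (con ½ :* e) in
                              y :+ d :+ d :+ d :+ d := y :+ e) refl y ε)
             (s₃ ⊕ ≤-refl {δ} ⊕ ≤-refl {δ} ⊕ ≤-refl {δ}))))

-- IsCeiling x z expresses z = ⌈ x ⌉.  It is a relation because the ceiling is not
-- a computable function of a real number.
IsCeiling : ℝ → ℤ → Set
IsCeiling x z = fromℤ (z ℤ.- + 1) <ℝ x × x ≤ℝ fromℤ z

------------------------------------------------------------------------
-- The exponential function, by its power series

-- expTerm q i = qⁱ / i!
expTerm : ℚ → ℕ → ℚ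
expTerm q zero    = 1ℚ
expTerm q (suc i) = expTerm q i * (q * (+ 1 / suc i))

module _ (q : ℚ) where
  private
    K : ℕ
    K = 2 ℕ.* ℤ.∣ ℚ.numerator q ∣

    ∣q∣≤ : ∣ q ∣ ≤ + ℤ.∣ ℚ.numerator q ∣ / 1
    ∣q∣≤ = go q
      where
      go : ∀ q → ∣ q ∣ ≤ + ℤ.∣ ℚ.numerator q ∣ / 1
      go q@(mkℚ a d _) = subst (_≤ + ℤ.∣ a ∣ / 1) (↥p/↧p≡p ∣ q ∣)
        (frac-≤ {ℤ.∣ a ∣} {d} {ℤ.∣ a ∣} {0} (ℕ.*-monoʳ-≤ ℤ.∣ a ∣ (s≤s z≤n)))

    u : ℕ → ℚ
    u i = ∣ expTerm q i ∣

    ratio : ∀ i → K ℕ.≤ i → ∣ q * (+ 1 / suc i) ∣ ≤ ½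
    ratio i h = begin
      ∣ q * (+ 1 / suc i) ∣                       ≡⟨ ∣p*q∣≡∣p∣*∣q∣ q _ ⟩
      ∣ q ∣ * ∣ + 1 / suc i ∣                     ≡⟨ cong (∣ q ∣ *_) (0≤p⇒∣p∣≡p (frac-nonNeg 1 i)) ⟩
      ∣ q ∣ * (+ 1 / suc i)                       ≤⟨ *-monoʳ (frac-nonNeg 1 i) ∣q∣≤ ⟩
      (+ a / 1) * (+ 1 / suc i)                   ≡⟨ frac-* a 1 0 i ⟩
      + (a ℕ.* 1) / (1 ℕ.* suc i)                 ≤⟨ frac-≤ {a ℕ.* 1} {i ℕ.+ 0} {1} {1} lem ⟩
      ½                                           ∎
      where
      open ≤-Reasoning
      a = ℤ.∣ ℚ.numerator q ∣
      lem : a ℕ.* 1 ℕ.* 2 ℕ.≤ 1 ℕ.* suc (i ℕ.+ 0)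
      lem rewrite ℕ.*-identityʳ a | ℕ.+-identityʳ i | ℕ.+-identityʳ i | ℕ.*-comm a 2 = ℕ.m≤n⇒m≤1+n h

    u-step : ∀ i → K ℕ.≤ i → u (suc i) ≤ half (u i)
    u-step i h = cast (sym (∣p*q∣≡∣p∣*∣q∣ (expTerm q i) _)) (*-comm (u i) ½)
      (*-monoˡ (0≤∣p∣ (expTerm q i)) (ratio i h))

    u-decay : ∀ j → u (j ℕ.+ K) ≤ u K * (+ 1 / suc j)
    u-decay zero    = ≤-reflexive (sym (*-identityʳ (u K)))
    u-decay (suc j) = begin
      u (suc j ℕ.+ K)                    ≤⟨ u-step (j ℕ.+ K) (ℕ.m≤n+m K j) ⟩
      ½ * u (j ℕ.+ K)                    ≤⟨ *-monoˡ (<⇒≤ 0<½) (u-decay j) ⟩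
      ½ * (u K * (+ 1 / suc j))          ≡⟨ solve 3 (λ h x y → h :* (x :* y) := x :* (h :* y)) refl ½ (u K) _ ⟩
      u K * (½ * (+ 1 / suc j))          ≡⟨ cong (u K *_) (frac-* 1 1 1 j) ⟩
      u K * (+ 1 / (2 ℕ.* suc j))        ≤⟨ *-monoˡ (0≤∣p∣ (expTerm q K))
                                              (frac-≤ {1} {j ℕ.+ suc (j ℕ.+ 0)} {1} {suc j} lem) ⟩
      u K * (+ 1 / suc (suc j))          ∎
      where
      open ≤-Reasoning
      lem : 1 ℕ.* suc (suc j) ℕ.≤ 1 ℕ.* suc (j ℕ.+ suc (j ℕ.+ 0))
      lem rewrite ℕ.+-identityʳ j | ℕ.+-suc j j | ℕ.+-identityʳ (j ℕ.+ j) = s≤s (s≤s (ℕ.m≤m+n j j))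

    S : ℕ → ℚ
    S m = Σ< m (expTerm q)

    2ℚ : ℚ
    2ℚ = 1ℚ + 1ℚ

    upper : ∀ p j → K ℕ.≤ j → S (p ℕ.+ j) + 2ℚ * u (p ℕ.+ j) ≤ S j + 2ℚ * u j
    upper zero    j h = ≤-refl
    upper (suc p) j h = ≤-trans (cast refl
        (solve 2 (λ s v → s :+ v :+ con 2ℚ :* (con ½ :* v) := s :+ con 2ℚ :* v) refl (S (p ℕ.+ j)) (u (p ℕ.+ j)))
        (≤-refl {S (p ℕ.+ j)} ⊕ p≤∣p∣ (expTerm q (p ℕ.+ j))
          ⊕ *-monoˡ (nonNegative⁻¹ 2ℚ) (u-step (p ℕ.+ j) (ℕ.≤-trans h (ℕ.m≤n+m j p)))))
      (upper p j h)

    lower : ∀ p j → K ℕ.≤ j → S j ≤ S (p ℕ.+ j) + 2ℚ * u j - 2ℚ * u (p ℕ.+ j)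
    lower zero    j h = ≤-reflexive
      (solve 2 (λ s v → s := s :+ v :- v) refl (S j) (2ℚ * u j))
    lower (suc p) j h = ≤-trans (lower p j h) (cast
        (solve 4 (λ s v w t → s :+ v :- con 2ℚ :* w :+ (t :+ :- t) := s :+ v :- con 2ℚ :* w)
           refl s (2ℚ * u j) w t)
        (solve 5 (λ s v w t x → s :+ v :- con 2ℚ :* w :+ (t :+ w) :+ (w :- con 2ℚ :* x)
                              := s :+ t :+ v :- con 2ℚ :* x)
           refl s (2ℚ * u j) w t (u (suc p ℕ.+ j)))
        (≤-trans (≤-refl {s + 2ℚ * u j - 2ℚ * w} ⊕ (≤-refl {t} ⊕ -p≤∣p∣ t))
          (p≤p+q (cast (solve 1 (λ x → con 2ℚ :* x :- con 2ℚ :* x := con 0ℚ) refl (u (suc p ℕ.+ j)))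
             (cong (_- 2ℚ * u (suc p ℕ.+ j)) (solve 1 (λ v → con 2ℚ :* (con ½ :* v) := v) refl w))
             (*-monoˡ (nonNegative⁻¹ 2ℚ) (u-step (p ℕ.+ j) (ℕ.≤-trans h (ℕ.m≤n+m j p)))
               ⊕ ≤-refl { - (2ℚ * u (suc p ℕ.+ j))})))))
      where
      s = S (p ℕ.+ j)
      w = u (p ℕ.+ j)
      t = expTerm q (p ℕ.+ j)

    S-upper : ∀ j m → K ℕ.≤ j → j ℕ.≤ m → S m ≤ S j + 2ℚ * u j
    S-upper j m h jm = ≤-trans (p≤p+q (*-nonNeg (nonNegative⁻¹ 2ℚ) (0≤∣p∣ (expTerm q m))))
      (subst (λ l → S l + 2ℚ * u l ≤ S j + 2ℚ * u j) (ℕ.m∸n+n≡m jm) (upper (m ℕ.∸ j) j h))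

    S-lower : ∀ j m → K ℕ.≤ j → j ℕ.≤ m → S j ≤ S m + 2ℚ * u j
    S-lower j m h jm = ≤-trans
      (subst (λ l → S j ≤ S l + 2ℚ * u j - 2ℚ * u l) (ℕ.m∸n+n≡m jm) (lower (m ℕ.∸ j) j h))
      (cast refl (+-identityʳ _) (≤-refl {S m + 2ℚ * u j}
        ⊕ neg-antimono-≤ (*-nonNeg (nonNegative⁻¹ 2ℚ) (0≤∣p∣ (expTerm q m)))))

    S-cauchy : IsCauchy S
    S-cauchy = ≤⇒cauchy λ ε hε →
      let hδ = half-pos (half-pos hε)
          (J , f) = archimedes* (0≤∣p∣ (expTerm q K)) hδ
          j = J ℕ.+ K
          hj = ℕ.m≤n+m K J
          uj = ≤-trans (u-decay J) (f J ℕ.≤-refl)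
      in j , λ m n hm hn → ≤-trans (S-upper j m hj hm)
           (≤-trans (S-lower j n hj hn ⊕ ≤-refl {2ℚ * u j})
           (cast refl (solve 2 (λ s e → let d = con 2ℚ :* (con ½ :* (con ½ :* e)) in
                                  s :+ d :+ d := s :+ e) refl (S n) ε)
              (≤-refl {S n} ⊕ *-monoˡ (nonNegative⁻¹ 2ℚ) uj ⊕ *-monoˡ (nonNegative⁻¹ 2ℚ) uj)))

  exp : ℝ
  exp = mkℝ (λ m → Σ< m (expTerm q)) S-cauchy

e : ℝ
e = exp 1ℚ

------------------------------------------------------------------------
-- Riemann integrals of nonnegative antitone functions, the logarithm and π

-- The right-endpoint Riemann sum of f over [a , a + L] with mesh 1/(s+1)
riemann : (ℚ → ℚ) → ℚ → ℕ → ℕ → ℚ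
riemann f a L s = Σ< (L ℕ.* suc s) (λ i → (+ 1 / suc s) * f (a + + suc i / suc s))

record AntitoneFrom (a : ℚ) (f : ℚ → ℚ) : Set where
  field
    nonneg   : ∀ x → a ≤ x → 0ℚ ≤ f x
    antitone : ∀ x y → a ≤ x → x ≤ y → f y ≤ f x

open AntitoneFrom

module _ (f : ℚ → ℚ) (a : ℚ) (L : ℕ) (h : AntitoneFrom a f) where
  private
    pt : ℕ → ℕ → ℚ
    pt s i = a + + i / suc s

    term : ℕ → ℕ → ℚ
    term s i = (+ 1 / suc s) * f (pt s i)

    left : ℕ → ℚ
    left s = Σ< (L ℕ.* suc s) (term s)

    a≤pt : ∀ s i → a ≤ pt s i
    a≤pt s i = p≤p+q (frac-nonNeg i s)

    pt≤pt : ∀ {s i r j} → i ℕ.* suc r ℕ.≤ j ℕ.* suc s → pt s i ≤ pt r j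
    pt≤pt {s} {i} {r} {j} b = ≤-refl {a} ⊕ frac-≤ {i} {s} {j} {r} b

    term-nonneg : ∀ s i → 0ℚ ≤ term s i
    term-nonneg s i = *-nonNeg (frac-nonNeg 1 s) (nonneg h _ (a≤pt s i))

    right≤left : ∀ s → riemann f a L s ≤ left s
    right≤left s = Σ-mono (L ℕ.* suc s) λ i _ → *-monoˡ (frac-nonNeg 1 s)
      (antitone h _ _ (a≤pt s i) (pt≤pt {s} {i} {s} {suc i} (ℕ.*-monoˡ-≤ (suc s) (ℕ.n≤1+n i))))

    left≤right : ∀ s → left s ≤ riemann f a L s + f a * (+ 1 / suc s)
    left≤right s = begin
      left s                              ≤⟨ p≤p+q {left s} (term-nonneg s (L ℕ.* suc s)) ⟩
      left s + term s (L ℕ.* suc s)       ≡⟨ sym (Σ-shift (L ℕ.* suc s) (term s)) ⟩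
      riemann f a L s + term s 0          ≡⟨ cong (_+_ (riemann f a L s)) eq ⟩
      riemann f a L s + f a * (+ 1 / suc s) ∎
      where
      open ≤-Reasoning
      eq : term s 0 ≡ f a * (+ 1 / suc s)
      eq = trans (cong (λ z → (+ 1 / suc s) * f z)
                   (trans (cong (_+_ a) (0/n≡0 (suc s))) (+-identityʳ a)))
                 (*-comm (+ 1 / suc s) (f a))

    -- suc (refine s t) = suc s * suc t
    refine : ℕ → ℕ → ℕ
    refine s t = t ℕ.+ s ℕ.* suc t

    block-const : ∀ s t c → Σ< (suc t) (λ _ → (+ 1 / suc (refine s t)) * c) ≡ (+ 1 / suc s) * c
    block-const s t c = trans (Σ-const (suc t) (refine s t) c)
      (cong (_* c) (frac-≡ {suc t} {refine s t} {1} {s}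
        (trans (ℕ.*-comm (suc t) (suc s)) (sym (ℕ.*-identityˡ _)))))

    blocks : ∀ s t g → Σ< (L ℕ.* suc (refine s t)) g
                     ≡ Σ< (L ℕ.* suc s) (λ i → Σ< (suc t) (λ j → g (i ℕ.* suc t ℕ.+ j)))
    blocks s t g = trans (cong (λ l → Σ< l g) (sym (ℕ.*-assoc L (suc s) (suc t))))
                         (Σ-block (L ℕ.* suc s) (suc t) g)

    right-refine : ∀ s t → riemann f a L s ≤ riemann f a L (refine s t)
    right-refine s t = cast refl (sym (blocks s t _))
      (Σ-mono (L ℕ.* suc s) λ i _ → cast (block-const s t _) refl
        (Σ-mono (suc t) λ j j<t → *-monoˡ (frac-nonNeg 1 (refine s t))
          (antitone h _ _ (a≤pt (refine s t) (suc (i ℕ.* suc t ℕ.+ j)))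
            (pt≤pt {refine s t} {suc (i ℕ.* suc t ℕ.+ j)} {s} {suc i}
            (bound i j j<t)))))
      where
      bound : ∀ i j → j ℕ.< suc t →
              suc (i ℕ.* suc t ℕ.+ j) ℕ.* suc s ℕ.≤ suc i ℕ.* suc (refine s t)
      bound i j j<t = begin
        suc (i ℕ.* suc t ℕ.+ j) ℕ.* suc s    ≡⟨ cong (ℕ._* suc s) (sym (ℕ.+-suc (i ℕ.* suc t) j)) ⟩
        (i ℕ.* suc t ℕ.+ suc j) ℕ.* suc s    ≤⟨ ℕ.*-monoˡ-≤ (suc s) (ℕ.+-monoʳ-≤ (i ℕ.* suc t) j<t) ⟩
        (i ℕ.* suc t ℕ.+ suc t) ℕ.* suc s    ≡⟨ cong (ℕ._* suc s) (ℕ.+-comm (i ℕ.* suc t) (suc t)) ⟩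
        suc i ℕ.* suc t ℕ.* suc s            ≡⟨ ℕ.*-assoc (suc i) (suc t) (suc s) ⟩
        suc i ℕ.* (suc t ℕ.* suc s)          ≡⟨ cong (suc i ℕ.*_) (ℕ.*-comm (suc t) (suc s)) ⟩
        suc i ℕ.* suc (refine s t)           ∎
        where open ℕ.≤-Reasoning

    left-refine : ∀ s t → left (refine s t) ≤ left s
    left-refine s t = cast (sym (blocks s t _)) refl
      (Σ-mono (L ℕ.* suc s) λ i _ → cast refl (block-const s t _)
        (Σ-mono (suc t) λ j _ → *-monoˡ (frac-nonNeg 1 (refine s t))
          (antitone h _ _ (a≤pt s i) (pt≤pt {s} {i} {refine s t} {i ℕ.* suc t ℕ.+ j} (bound i j)))))
      where
      bound : ∀ i j → i ℕ.* suc (refine s t) ℕ.≤ (i ℕ.* suc t ℕ.+ j) ℕ.* suc s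
      bound i j = begin
        i ℕ.* (suc s ℕ.* suc t)          ≡⟨ cong (i ℕ.*_) (ℕ.*-comm (suc s) (suc t)) ⟩
        i ℕ.* (suc t ℕ.* suc s)          ≡⟨ sym (ℕ.*-assoc i (suc t) (suc s)) ⟩
        i ℕ.* suc t ℕ.* suc s            ≤⟨ ℕ.*-monoˡ-≤ (suc s) (ℕ.m≤m+n (i ℕ.* suc t) j) ⟩
        (i ℕ.* suc t ℕ.+ j) ℕ.* suc s    ∎
        where open ℕ.≤-Reasoning

    right≤left′ : ∀ s t → riemann f a L s ≤ left t
    right≤left′ s t = ≤-trans (right-refine s t) (≤-trans (right≤left (refine s t))
      (subst (λ r → left r ≤ left t) (ℕ.suc-injective (ℕ.*-comm (suc t) (suc s))) (left-refine t s)))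

  riemann-close : ∀ s t → riemann f a L s ≤ riemann f a L t + f a * (+ 1 / suc t)
  riemann-close s t = ≤-trans (right≤left′ s t) (left≤right t)

  -- ∫ f from a to a + L
  integral : ℝ
  integral = mkℝ (riemann f a L) (≤⇒cauchy λ ε hε →
    let (N , g) = archimedes* (nonneg h a ≤-refl) hε
    in N , λ m n _ hn → ≤-trans (riemann-close m n) (≤-refl {riemann f a L n} ⊕ g n hn))

recip-antitone : AntitoneFrom 1ℚ recip
recip-antitone = record
  { nonneg   = λ _ hx → recip-nonNeg (<-≤-trans (positive⁻¹ 1ℚ) hx)
  ; antitone = λ _ _ hx → recip-anti (<-≤-trans (positive⁻¹ 1ℚ) hx)
  }

-- log N = ∫ dt/t from 1 to N
log : (N : ℕ) .{{_ : ℕ.NonZero N}} → ℝ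
log (suc N) = integral recip 1ℚ N recip-antitone

cauchyDensity : ℚ → ℚ
cauchyDensity t = recip (1ℚ + t * t)

1+t²-pos : ∀ t → 0ℚ ≤ t → 0ℚ < 1ℚ + t * t
1+t²-pos t ht = subst (_< 1ℚ + t * t) (+-identityʳ 0ℚ)
  (+-mono-<-≤ (positive⁻¹ 1ℚ) (*-nonNeg ht ht))

cauchyDensity-antitone : AntitoneFrom 0ℚ cauchyDensity
cauchyDensity-antitone = record
  { nonneg   = λ t ht → recip-nonNeg (1+t²-pos t ht)
  ; antitone = λ t u ht tu → recip-anti (1+t²-pos t ht)
      (≤-refl {1ℚ} ⊕ *-mono ht (≤-trans ht tu) tu tu)
  }

-- π = 4 arctan 1, with arctan 1 = ∫ dt/(1 + t²) from 0 to 1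
π : ℝ
π = fromℕᴿ 4 *ℝ integral cauchyDensity 0ℚ 1 cauchyDensity-antitone

------------------------------------------------------------------------
-- Euler's constant

harmonic : ℕ → ℚ
harmonic m = Σ< m (λ i → + 1 / suc i)

-- The sequence is indexed from m = 1, so that log m is defined.
γ-approx : ℕ → ℝ
γ-approx m = fromℚ (harmonic (suc m)) -ℝ log (suc m)

recip-suc : ∀ p → recip (1ℚ + + p / 1) ≡ + 1 / suc p
recip-suc p = recip-unique
  (subst (_< 1ℚ + + p / 1) (+-identityʳ 0ℚ) (+-mono-<-≤ (positive⁻¹ 1ℚ) (frac-nonNeg p 0)))
  (trans (cong (_* (+ 1 / suc p)) (frac-+ 1 p 0))
  (trans (frac-* (suc p) 1 0 p)
         (frac-≡ {suc p ℕ.* 1} {p ℕ.+ 0} {1} {0} lem)))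
  where
  lem : suc p ℕ.* 1 ℕ.* 1 ≡ 1 ℕ.* suc (p ℕ.+ 0)
  lem rewrite ℕ.*-identityʳ p | ℕ.*-identityʳ p | ℕ.+-identityʳ p | ℕ.+-identityʳ p = refl

-- the part of the Riemann sum for log coming from [p + 1 , p + 2]
logBlock : ℕ → ℕ → ℚ
logBlock s p = Σ< (suc s) (λ j → (+ 1 / suc s) * recip (1ℚ + + suc (p ℕ.* suc s ℕ.+ j) / suc s))

mean : ∀ s c → Σ< (suc s) (λ _ → (+ 1 / suc s) * c) ≡ c
mean s c = trans (Σ-const (suc s) s c)
  (trans (cong (_* c) (frac-≡ {suc s} {s} {1} {0} (ℕ.*-comm (suc s) 1))) (*-identityˡ c))

logBlock-upper : ∀ s p → logBlock s p ≤ + 1 / suc p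
logBlock-upper s p = cast refl (trans (mean s _) (recip-suc p))
  (Σ-mono (suc s) λ j _ → *-monoˡ (frac-nonNeg 1 s)
    (recip-anti (subst (_< 1ℚ + + p / 1) (+-identityʳ 0ℚ) (+-mono-<-≤ (positive⁻¹ 1ℚ) (frac-nonNeg p 0)))
      (≤-refl {1ℚ} ⊕ frac-≤ {p} {0} {suc (p ℕ.* suc s ℕ.+ j)} {s}
        (ℕ.≤-trans (ℕ.m≤m+n (p ℕ.* suc s) (suc j))
          (ℕ.≤-reflexive (trans (ℕ.+-suc (p ℕ.* suc s) j) (sym (ℕ.*-identityʳ _))))))))

logBlock-lower : ∀ s p → + 1 / suc (suc p) ≤ logBlock s p
logBlock-lower s p = cast (trans (mean s _) (recip-suc (suc p))) refl
  (Σ-mono (suc s) λ j j<s → *-monoˡ (frac-nonNeg 1 s)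
    (recip-anti (subst (_< 1ℚ + + suc (p ℕ.* suc s ℕ.+ j) / suc s) (+-identityʳ 0ℚ)
                  (+-mono-<-≤ (positive⁻¹ 1ℚ) (frac-nonNeg (suc (p ℕ.* suc s ℕ.+ j)) s)))
      (≤-refl {1ℚ} ⊕ frac-≤ {suc (p ℕ.* suc s ℕ.+ j)} {s} {suc p} {0}
        (ℕ.≤-trans (ℕ.≤-reflexive (trans (ℕ.*-identityʳ _) (sym (ℕ.+-suc (p ℕ.* suc s) j))))
        (ℕ.≤-trans (ℕ.+-monoʳ-≤ (p ℕ.* suc s) j<s)
          (ℕ.≤-reflexive (ℕ.+-comm (p ℕ.* suc s) (suc s))))))))

γ-step : ∀ p s → seq (γ-approx (suc p)) s
               ≡ seq (γ-approx p) s + (+ 1 / suc (suc p) - logBlock s p)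
γ-step p s = trans (cong (λ z → harmonic (suc (suc p)) - z) (Σ-block-suc p (suc s) _))
  (solve 4 (λ H x R B → H :+ x :- (R :+ B) := H :- R :+ (x :- B)) refl
     (harmonic (suc p)) (+ 1 / suc (suc p)) (riemann recip 1ℚ p s) (logBlock s p))

γ-down : ∀ d p s → seq (γ-approx (d ℕ.+ p)) s ≤ seq (γ-approx p) s
γ-down zero    p s = ≤-refl
γ-down (suc d) p s = ≤-trans (≤-reflexive (γ-step (d ℕ.+ p) s))
  (≤-trans (cast refl (solve 2 (λ g x → g :+ (x :- x) := g) refl (seq (γ-approx (d ℕ.+ p)) s) B)
      (≤-refl {seq (γ-approx (d ℕ.+ p)) s} ⊕ (logBlock-lower s (d ℕ.+ p) ⊕ ≤-refl { - B})))
    (γ-down d p s))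
  where
  B = logBlock s (d ℕ.+ p)

γ-up : ∀ d p s → seq (γ-approx p) s
               ≤ seq (γ-approx (d ℕ.+ p)) s + + 1 / suc p - + 1 / suc (d ℕ.+ p)
γ-up zero    p s = ≤-reflexive
  (solve 2 (λ g x → g := g :+ x :- x) refl (seq (γ-approx p) s) (+ 1 / suc p))
γ-up (suc d) p s = ≤-trans (γ-up d p s) (cast
  (solve 4 (λ g x y B → g :+ x :- y :+ (B :- B) := g :+ x :- y) refl g x y B)
  (trans (solve 5 (λ g x y z B → g :+ x :- y :+ (y :- B) := g :+ (z :- B) :+ x :- z) refl g x y z B)
         (cong (λ w → w + x - z) (sym (γ-step (d ℕ.+ p) s))))
  (≤-refl {g + x - y} ⊕ (logBlock-upper s (d ℕ.+ p) ⊕ ≤-refl { - B})))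
  where
  g = seq (γ-approx (d ℕ.+ p)) s
  x = + 1 / suc p
  y = + 1 / suc (d ℕ.+ p)
  z = + 1 / suc (suc (d ℕ.+ p))
  B = logBlock s (d ℕ.+ p)

γ-up′ : ∀ d p s → seq (γ-approx p) s ≤ seq (γ-approx (d ℕ.+ p)) s + + 1 / suc p
γ-up′ d p s = ≤-trans (γ-up d p s) (cast refl (+-identityʳ _)
  (≤-refl {seq (γ-approx (d ℕ.+ p)) s + + 1 / suc p}
    ⊕ neg-antimono-≤ (frac-nonNeg 1 (d ℕ.+ p))))

γ-cauchy : IsCauchyℝ γ-approx
γ-cauchy ε hε = N , λ m n hm hn δ hδ → 0 , λ s _ → ≤-trans (bound m n hm hn s) (p≤p+q (<⇒≤ hδ))
  where
  N = proj₁ (archimedes hε)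
  bound : ∀ m n → N ℕ.≤ m → N ℕ.≤ n → ∀ s → seq (γ-approx m) s ≤ seq (γ-approx n) s + ε
  bound m n hm hn s with ℕ.≤-total m n
  ... | inj₁ m≤n = ≤-trans
    (subst (λ l → seq (γ-approx m) s ≤ seq (γ-approx l) s + + 1 / suc m)
           (ℕ.m∸n+n≡m m≤n) (γ-up′ (n ℕ.∸ m) m s))
    (≤-refl {seq (γ-approx n) s} ⊕ proj₂ (archimedes hε) m hm)
  ... | inj₂ n≤m = ≤-trans
    (subst (λ l → seq (γ-approx l) s ≤ seq (γ-approx n) s) (ℕ.m∸n+n≡m n≤m) (γ-down (m ℕ.∸ n) n s))
    (p≤p+q (<⇒≤ hε))

-- γ = lim (1 + 1/2 + … + 1/m - log m)
γ : ℝ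
γ = lim γ-approx γ-cauchy

------------------------------------------------------------------------
-- Records of permutations and optimization sets

words : {A : Set} → List A → ∀ m → List (Vec A m)
words xs zero    = [] ∷ []
words xs (suc m) = List.cartesianProductWith _∷_ xs (words xs m)

unique? : ∀ {n} (σ : Vec (Fin n) n) → Dec (Unique σ)
unique? = AllPairs.allPairs? (λ i j → ¬? (i Fin.≟ j))

-- The permutations of Fin n in one-line notation.  Positions and values are
-- counted from 0, which affects neither records nor weights.
permutations : ∀ n → List (Vec (Fin n) n)
permutations n = filter unique? (words (allFin n) n)

permutationTuples : ∀ k n → List (Vec (Vec (Fin n) n) k)
permutationTuples k n = words (permutations n) k

IsRecord : ∀ {n} → Fin n → Vec (Fin n) n → Set
IsRecord α σ = ∀ α′ → α′ Fin.< α → lookup σ α Fin.< lookup σ α′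

isRecord? : ∀ {n} (α : Fin n) (σ : Vec (Fin n) n) → Dec (IsRecord α σ)
isRecord? α σ = Fin.all? (λ α′ → (α′ Fin.<? α) →-dec (lookup σ α Fin.<? lookup σ α′))

recordCount : ∀ {k n} → Vec (Vec (Fin n) n) k → Fin n → Fin (suc k)
recordCount σs α = fromℕ< (s≤s (count≤n (isRecord? α) σs))

optimizationSet : ∀ {k n} → Vec (Fin 2) (suc k) → Vec (Vec (Fin n) n) k → Subset n
optimizationSet c σs = tabulate λ α → does (lookup c (recordCount σs α) Fin.≟ suc zero)

weight : ∀ {k n} → Vec (Fin 2) (suc k) → Vec (Vec (Fin n) n) k → ℕ
weight c σs = card (optimizationSet c σs)

O : ∀ {k} → Vec (Fin 2) (suc k) → ℕ → ℤ → ℕ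
O {k} c n m = length (filter (λ σs → + weight c σs ℤ.≟ m) (permutationTuples k n))

P : ∀ {k} → Vec (Fin 2) (suc k) → ℕ → ℤ → ℚ
P {k} c n m = _/_ (+ O c n m) ((n !) ℕ.^ k) {{ℕ.m^n≢0 (n !) k {{n !≢0}}}}

-- Σ f m over the integers m with a ≤ m < b
Σℤ : ℤ → ℤ → (ℤ → ℚ) → ℚ
Σℤ a b f = Σ< ℤ.∣ (b ℤ.- a) ℤ.⊔ + 0 ∣ (λ i → f (a ℤ.+ + i))

complement : ∀ {m} → Vec (Fin 2) m → Vec (Fin 2) m
complement = Vec.map opposite

-- Σ c_β (k choose β) over 2 ≤ β ≤ k
binomialSum : ∀ {k} → Vec (Fin 2) (suc k) → ℕ
binomialSum {k} c = sum (List.map (λ β → toℕ (lookup c β) ℕ.* (k C toℕ β))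
                                       (filter (λ β → 2 ℕ.≤? toℕ β) (allFin (suc k))))

-- e k c₁ (log (n - 1) + γ) + (e π² / 6) Σ c_β (k choose β)
threshold : ∀ {k} n → 2 ℕ.≤ n → 1 ℕ.≤ k → Vec (Fin 2) (suc k) → ℝ
threshold {k} n 2≤n 1≤k c =
  e *ℝ fromℕᴿ k *ℝ fromℕᴿ (toℕ (lookup c (fromℕ< (s≤s 1≤k))))
    *ℝ (log (n ℕ.∸ 1) {{ℕ.>-nonZero (ℕ.m<n⇒0<n∸m 2≤n)}} +ℝ γ)
  +ℝ e *ℝ (π *ℝ π) *ℝ fromℚ (+ 1 / 6) *ℝ fromℕᴿ (binomialSum c)

{-# OPTIONS --safe #-}

-- A position α of a uniformly random permutation is a record with probability
-- 1/α, independently over α: removing the last value leaves a random permutation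
-- with the same earlier records.  Hence, apart from position 1, which contributes
-- c_k, the weight is a sum Y of independent indicators, and E 3^Y = Π (1 + 2 p_α)
-- with p_α ≤ k c₁ / α + Σ_{β≥2} c_β (k choose β) / α² if c₀ = 0.  Markov's inequality
-- for 3^Y, in place of e^Y, keeps all the probabilities rational and still gives the
-- bound: Π (1 + 2 p_α) ≤ exp (2 Σ p_α) ≤ exp z ≤ 3^z for the integer z = ⌈threshold⌉,
-- so P(Y ≥ z + M₁) ≤ 3^(-M₁) ≤ exp (-M₁).  Part (ii) is the same bound for the
-- complement of c, whose indicators are the complementary ones.
module Submission where

open import Defs
open import Data.Nat.Base as ℕ using (ℕ; zero; suc; z≤n; s≤s; _!)
import Data.Nat.Properties as ℕ
open import Data.Nat.ListAction using (sum)
open import Data.Nat.ListAction.Properties using (sum-++)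
open import Data.Nat.Tactic.RingSolver using (solve-∀)
open import Data.Integer.Base as ℤ using (ℤ)
import Data.Integer.Properties as ℤ
open import Data.Integer.Tactic.RingSolver using () renaming (solve-∀ to ℤ-solve-∀)
import Data.Rational.Properties as ℚ
open import Data.Bool.Base using (Bool; true; false; if_then_else_; _∧_)
open import Data.Empty using (⊥-elim)
open import Data.Fin.Base as Fin using (Fin; zero; suc; toℕ; fromℕ; inject₁; punchIn; punchOut)
import Data.Fin.Properties as Fin
open import Data.Fin.Relation.Unary.Top using (view; ‵fromℕ; ‵inject₁)
open import Data.Fin.Subset using (Subset) renaming (∣_∣ to card)
open import Data.List.Base as List using (List; []; _∷_; allFin; filter)
import Data.List.Properties as List
open import Data.Product.Base using (_×_; _,_; ∃)
open import Data.Sum.Base using (_⊎_; inj₁; inj₂)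
open import Data.Unit.Base using (tt)
open import Data.Vec.Base as Vec using (Vec; []; _∷_; _∷ʳ_; count; lookup)
open import Data.Vec.Properties using (lookup-map)
import Data.Vec.Relation.Unary.All as All
import Data.Vec.Relation.Unary.All.Properties as All
import Data.Vec.Relation.Unary.AllPairs as AllPairs
open import Data.Vec.Relation.Unary.Unique.Propositional using (Unique; []; _∷_)
import Data.Vec.Relation.Unary.Unique.Propositional.Properties as Unique
open import Function.Base using (_∘_; id; it)
open import Relation.Nullary.Decidable using (Dec; does; yes; no; ¬?; _→-dec_; toWitness)
open import Relation.Nullary.Negation using (¬_; contradiction)
open import Relation.Binary.PropositionalEquality

-- The slack comes from the two coefficients of the threshold: 2 Σ p_α stays below it because 2 (H_n
-- - 1) ≤ e (log (n - 1) + γ) and 2 Σ 1/α² ≤ 2 ≤ e π²/6, where α ≥ 2 in both sums. The first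
-- inequality is tightest to handle at n = 2: there the logarithm vanishes and e γ ≥ 1 has to carry
-- it alone, so a numerical lower bound for γ is required. Reals are Cauchy sequences of rationals
-- and their order holds only eventually and up to ε. So the expectation of 3^Y is kept as a natural
-- number, multiplied by n!^k, and exponentials enter as rational partial sums whose lengths are
-- tracked. The last step, 3^(-M₁) ≤ exp (-M₁), concerns a series with alternating signs; it is
-- reduced to e ≤ 3 by showing that the partial sums at -M₁ and M₁ have a product close to 1.

module Counting where
  open import Data.Nat.Base
  open import Data.Nat.Combinatorics
    using (_C_; k>n⇒nCk≡0; nCk≡nC[n∸k]; nCn≡1; nC1≡n; nCk+nC[k+1]≡[n+1]C[k+1])
  open import Data.Nat.Properties

  private
    variable
      A B D : Set
      m n N : ℕ

  -- Finite sums, indicators and products over the naturals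

  ∑ : List A → (A → ℕ) → ℕ
  ∑ xs f = sum (List.map f xs)

  ∑-cong : ∀ (xs : List A) {f g : A → ℕ} → (∀ x → f x ≡ g x) → ∑ xs f ≡ ∑ xs g
  ∑-cong xs h = cong sum (List.map-cong h xs)

  ∑-mono : ∀ (xs : List A) {f g : A → ℕ} → (∀ x → f x ≤ g x) → ∑ xs f ≤ ∑ xs g
  ∑-mono []       h = z≤n
  ∑-mono (x ∷ xs) h = +-mono-≤ (h x) (∑-mono xs h)

  ∑-++ : ∀ (xs ys : List A) f → ∑ (xs List.++ ys) f ≡ ∑ xs f + ∑ ys f
  ∑-++ xs ys f = trans (cong sum (List.map-++ f xs ys)) (sum-++ (List.map f xs) _)

  ∑-map : ∀ (xs : List A) (h : A → B) f → ∑ (List.map h xs) f ≡ ∑ xs (f ∘ h)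
  ∑-map xs h f = cong sum (sym (List.map-∘ xs))

  ∑-zero : ∀ (xs : List A) → ∑ xs (λ _ → 0) ≡ 0
  ∑-zero []       = refl
  ∑-zero (x ∷ xs) = ∑-zero xs

  ∑-+ : ∀ (xs : List A) f g → ∑ xs (λ x → f x + g x) ≡ ∑ xs f + ∑ xs g
  ∑-+ []       f g = refl
  ∑-+ (x ∷ xs) f g rewrite ∑-+ xs f g = lem (f x) (g x) (∑ xs f) (∑ xs g)
    where
    lem : ∀ a b c d → a + b + (c + d) ≡ a + c + (b + d)
    lem = solve-∀

  ∑-*ˡ : ∀ (xs : List A) c f → ∑ xs (λ x → c * f x) ≡ c * ∑ xs f
  ∑-*ˡ []       c f = sym (*-zeroʳ c)
  ∑-*ˡ (x ∷ xs) c f rewrite ∑-*ˡ xs c f = sym (*-distribˡ-+ c (f x) _)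

  ∑-*ʳ : ∀ (xs : List A) c f → ∑ xs (λ x → f x * c) ≡ ∑ xs f * c
  ∑-*ʳ xs c f = trans (∑-cong xs (λ x → *-comm (f x) c)) (trans (∑-*ˡ xs c f) (*-comm c _))

  ∑-swap : ∀ (xs : List A) (ys : List B) (f : A → B → ℕ) →
           ∑ xs (λ x → ∑ ys (f x)) ≡ ∑ ys (λ y → ∑ xs (λ x → f x y))
  ∑-swap []       ys f = sym (∑-zero ys)
  ∑-swap (x ∷ xs) ys f = trans (cong (∑ ys (f x) +_) (∑-swap xs ys f))
    (sym (∑-+ ys (f x) (λ y → ∑ xs (λ x → f x y))))

  ∑-product : ∀ (h : A → B → D) xs ys f →
              ∑ (List.cartesianProductWith h xs ys) f ≡ ∑ xs (λ x → ∑ ys (λ y → f (h x y)))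
  ∑-product h []       ys f = refl
  ∑-product h (x ∷ xs) ys f = trans (∑-++ (List.map (h x) ys) _ f)
    (cong₂ _+_ (∑-map ys (h x) f) (∑-product h xs ys f))

  ∑-allFin : ∀ n (f : Fin (suc n) → ℕ) → ∑ (allFin (suc n)) f ≡ f zero + ∑ (allFin n) (f ∘ suc)
  ∑-allFin n f = cong (f zero +_) (trans (cong (λ l → ∑ l f) (sym (List.map-tabulate id suc)))
    (∑-map (allFin n) suc f))

  ∑-const : ∀ n c → ∑ (allFin n) (λ _ → c) ≡ n * c
  ∑-const zero    c = refl
  ∑-const (suc n) c = trans (∑-allFin n (λ _ → c)) (cong (c +_) (∑-const n c))

  bit : Bool → ℕ
  bit b = if b then 1 else 0

  𝟙 : {P : Set} → Dec P → ℕ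
  𝟙 d = bit (does d)

  bit-∧ : ∀ a b → bit (a ∧ b) ≡ bit a * bit b
  bit-∧ true  b = sym (+-identityʳ _)
  bit-∧ false b = refl

  𝟙-yes : {P : Set} (p? : Dec P) → P → 𝟙 p? ≡ 1
  𝟙-yes (yes _) p = refl
  𝟙-yes (no ¬p) p = contradiction p ¬p

  𝟙-no : {P : Set} (p? : Dec P) → ¬ P → 𝟙 p? ≡ 0
  𝟙-no (yes p) ¬p = contradiction p ¬p
  𝟙-no (no _)  ¬p = refl

  𝟙-cong : {P Q : Set} (p? : Dec P) (q? : Dec Q) → (P → Q) → (Q → P) → 𝟙 p? ≡ 𝟙 q?
  𝟙-cong p? (yes q) f g = 𝟙-yes p? (g q)
  𝟙-cong p? (no ¬q) f g = 𝟙-no p? (¬q ∘ f)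

  ∑-filter : ∀ {P : A → Set} (P? : ∀ x → Dec (P x)) xs f →
             ∑ (filter P? xs) f ≡ ∑ xs (λ x → 𝟙 (P? x) * f x)
  ∑-filter P? []       f = refl
  ∑-filter P? (x ∷ xs) f with does (P? x)
  ... | true  = cong₂ _+_ (sym (+-identityʳ (f x))) (∑-filter P? xs f)
  ... | false = ∑-filter P? xs f

  length-filter : ∀ {P : A → Set} (P? : ∀ x → Dec (P x)) xs →
                  List.length (filter P? xs) ≡ ∑ xs (λ x → 𝟙 (P? x))
  length-filter P? []       = refl
  length-filter P? (x ∷ xs) with does (P? x)
  ... | true  = cong suc (length-filter P? xs)
  ... | false = length-filter P? xs

  count-∷ : ∀ {P : A → Set} (P? : ∀ x → Dec (P x)) x (xs : Vec A n) →
            count P? (x ∷ xs) ≡ 𝟙 (P? x) + count P? xs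
  count-∷ P? x xs with does (P? x)
  ... | true  = refl
  ... | false = refl

  ∏ : ∀ n → (Fin n → ℕ) → ℕ
  ∏ zero    f = 1
  ∏ (suc n) f = f zero * ∏ n (f ∘ suc)

  ∏-cong : ∀ n {f g : Fin n → ℕ} → (∀ i → f i ≡ g i) → ∏ n f ≡ ∏ n g
  ∏-cong zero    h = refl
  ∏-cong (suc n) h = cong₂ _*_ (h zero) (∏-cong n (h ∘ suc))

  ∏-last : ∀ n (f : Fin (suc n) → ℕ) → ∏ (suc n) f ≡ ∏ n (f ∘ inject₁) * f (fromℕ n)
  ∏-last zero    f = *-comm (f zero) 1
  ∏-last (suc n) f = trans (cong (f zero *_) (∏-last n (f ∘ suc)))
    (sym (*-assoc (f zero) (∏ n (f ∘ suc ∘ inject₁)) (f (fromℕ (suc n)))))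

  -- Words, and the removal of their last letter

  ∑-words : ∀ (xs : List A) m f →
            ∑ (words xs (suc m)) f ≡ ∑ xs (λ x → ∑ (words xs m) (λ w → f (x ∷ w)))
  ∑-words xs m f = ∑-product _∷_ xs (words xs m) f

  -- `words` grows at the front, whereas deleting a letter leaves the other records unchanged only
  -- at the end; the expansion is therefore moved to the last letter.
  ∑-words-∷ʳ : ∀ (xs : List A) m f →
               ∑ (words xs (suc m)) f ≡ ∑ xs (λ v → ∑ (words xs m) (λ w → f (w ∷ʳ v)))
  ∑-words-∷ʳ xs zero    f = ∑-words xs zero f
  ∑-words-∷ʳ xs (suc m) f = begin
    ∑ (words xs (suc (suc m))) f
      ≡⟨ ∑-words xs (suc m) f ⟩
    ∑ xs (λ x → ∑ (words xs (suc m)) (λ w → f (x ∷ w)))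
      ≡⟨ ∑-cong xs (λ x → ∑-words-∷ʳ xs m (λ w → f (x ∷ w))) ⟩
    ∑ xs (λ x → ∑ xs (λ v → ∑ (words xs m) (λ w → f (x ∷ (w ∷ʳ v)))))
      ≡⟨ ∑-swap xs xs _ ⟩
    ∑ xs (λ v → ∑ xs (λ x → ∑ (words xs m) (λ w → f (x ∷ (w ∷ʳ v)))))
      ≡⟨ ∑-cong xs (λ v → sym (∑-words xs m (λ w → f (w ∷ʳ v)))) ⟩
    ∑ xs (λ v → ∑ (words xs (suc m)) (λ w → f (w ∷ʳ v))) ∎
    where open ≡-Reasoning

  avoids : Fin N → Vec (Fin N) m → ℕ
  avoids v []      = 1
  avoids v (x ∷ w) = 𝟙 (¬? (x Fin.≟ v)) * avoids v w

  ∑-punchIn : ∀ n (v : Fin (suc n)) f →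
              ∑ (allFin (suc n)) (λ x → 𝟙 (¬? (x Fin.≟ v)) * f x) ≡ ∑ (allFin n) (f ∘ punchIn v)
  ∑-punchIn n       zero    f = trans (∑-allFin n (λ x → 𝟙 (¬? (x Fin.≟ zero)) * f x))
    (∑-cong (allFin n) (λ x → +-identityʳ (f (suc x))))
  ∑-punchIn (suc n) (suc v) f = trans (∑-allFin (suc n) (λ x → 𝟙 (¬? (x Fin.≟ suc v)) * f x))
    (trans (cong₂ _+_ (+-identityʳ (f zero)) (trans
              (∑-cong (allFin (suc n)) (λ x → cong (_* f (suc x)) (𝟙-cong
                 (¬? (suc x Fin.≟ suc v)) (¬? (x Fin.≟ v))
                 (λ h e → h (cong suc e)) (λ h e → h (Fin.suc-injective e)))))
              (∑-punchIn n v (f ∘ suc))))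
           (sym (∑-allFin n (f ∘ punchIn (suc v)))))

  -- Letter by letter, `punchIn v` is a bijection onto the letters other than `v`. This
  -- standardisation turns a permutation without its last value into a permutation of one letter
  -- fewer.
  ∑-words-avoiding : ∀ n m (v : Fin (suc n)) f →
    ∑ (words (allFin (suc n)) m) (λ w → avoids v w * f w) ≡
    ∑ (words (allFin n) m) (λ w → f (Vec.map (punchIn v) w))
  ∑-words-avoiding n zero    v f = cong (_+ 0) (+-identityʳ (f []))
  ∑-words-avoiding n (suc m) v f = begin
    ∑ (words X (suc m)) (λ w → avoids v w * f w)
      ≡⟨ ∑-words X m _ ⟩
    ∑ X (λ x → ∑ (words X m) (λ w → 𝟙 (¬? (x Fin.≟ v)) * avoids v w * f (x ∷ w)))
      ≡⟨ ∑-cong X (λ x → trans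
           (∑-cong (words X m) (λ w → *-assoc (𝟙 (¬? (x Fin.≟ v))) (avoids v w) (f (x ∷ w))))
           (∑-*ˡ (words X m) (𝟙 (¬? (x Fin.≟ v))) (λ w → avoids v w * f (x ∷ w)))) ⟩
    ∑ X (λ x → 𝟙 (¬? (x Fin.≟ v)) * ∑ (words X m) (λ w → avoids v w * f (x ∷ w)))
      ≡⟨ ∑-punchIn n v _ ⟩
    ∑ Y (λ x → ∑ (words X m) (λ w → avoids v w * f (punchIn v x ∷ w)))
      ≡⟨ ∑-cong Y (λ x → ∑-words-avoiding n m v (λ w → f (punchIn v x ∷ w))) ⟩
    ∑ Y (λ x → ∑ (words Y m) (λ w → f (punchIn v x ∷ Vec.map (punchIn v) w)))
      ≡⟨ sym (∑-words Y m (λ w → f (Vec.map (punchIn v) w))) ⟩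
    ∑ (words Y (suc m)) (λ w → f (Vec.map (punchIn v) w)) ∎
    where
    open ≡-Reasoning
    X = allFin (suc n)
    Y = allFin n

  -- Unfolds to the same decision as `unique?`, but for words whose length and alphabet may differ,
  -- as happens once the last letter is split off.
  distinct? : (w : Vec (Fin N) m) → Dec (Unique w)
  distinct? = AllPairs.allPairs? (λ i j → ¬? (i Fin.≟ j))

  distinct-∷ʳ : ∀ (w : Vec (Fin N) m) v → 𝟙 (distinct? (w ∷ʳ v)) ≡ avoids v w * 𝟙 (distinct? w)
  distinct-∷ʳ []      v = refl
  distinct-∷ʳ (x ∷ w) v = begin
    𝟙 (distinct? (x ∷ (w ∷ʳ v)))
      ≡⟨ bit-∧ (does (All.all? (λ y → ¬? (x Fin.≟ y)) (w ∷ʳ v))) _ ⟩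
    𝟙 (All.all? (λ y → ¬? (x Fin.≟ y)) (w ∷ʳ v)) * 𝟙 (distinct? (w ∷ʳ v))
      ≡⟨ cong₂ _*_ (all-∷ʳ w) (distinct-∷ʳ w v) ⟩
    𝟙 (¬? (x Fin.≟ v)) * 𝟙 (All.all? (λ y → ¬? (x Fin.≟ y)) w) * (avoids v w * 𝟙 (distinct? w))
      ≡⟨ lem (𝟙 (¬? (x Fin.≟ v))) _ (avoids v w) _ ⟩
    𝟙 (¬? (x Fin.≟ v)) * avoids v w * (𝟙 (All.all? (λ y → ¬? (x Fin.≟ y)) w) * 𝟙 (distinct? w))
      ≡⟨ cong (𝟙 (¬? (x Fin.≟ v)) * avoids v w *_)
           (sym (bit-∧ (does (All.all? (λ y → ¬? (x Fin.≟ y)) w)) _)) ⟩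
    𝟙 (¬? (x Fin.≟ v)) * avoids v w * 𝟙 (distinct? (x ∷ w)) ∎
    where
    open ≡-Reasoning
    lem : ∀ a b c d → a * b * (c * d) ≡ a * c * (b * d)
    lem = solve-∀
    all-∷ʳ : ∀ {l} (u : Vec (Fin _) l) → 𝟙 (All.all? (λ y → ¬? (x Fin.≟ y)) (u ∷ʳ v))
           ≡ 𝟙 (¬? (x Fin.≟ v)) * 𝟙 (All.all? (λ y → ¬? (x Fin.≟ y)) u)
    all-∷ʳ []      = bit-∧ (does (¬? (x Fin.≟ v))) true
    all-∷ʳ (y ∷ u) = begin
      𝟙 (All.all? (λ y → ¬? (x Fin.≟ y)) (y ∷ (u ∷ʳ v)))
        ≡⟨ bit-∧ (does (¬? (x Fin.≟ y))) _ ⟩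
      𝟙 (¬? (x Fin.≟ y)) * 𝟙 (All.all? (λ y → ¬? (x Fin.≟ y)) (u ∷ʳ v))
        ≡⟨ cong (𝟙 (¬? (x Fin.≟ y)) *_) (all-∷ʳ u) ⟩
      𝟙 (¬? (x Fin.≟ y)) * (𝟙 (¬? (x Fin.≟ v)) * 𝟙 (All.all? (λ y → ¬? (x Fin.≟ y)) u))
        ≡⟨ lem′ (𝟙 (¬? (x Fin.≟ y))) (𝟙 (¬? (x Fin.≟ v))) _ ⟩
      𝟙 (¬? (x Fin.≟ v)) * (𝟙 (¬? (x Fin.≟ y)) * 𝟙 (All.all? (λ y → ¬? (x Fin.≟ y)) u))
        ≡⟨ cong (𝟙 (¬? (x Fin.≟ v)) *_) (sym (bit-∧ (does (¬? (x Fin.≟ y))) _)) ⟩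
      𝟙 (¬? (x Fin.≟ v)) * 𝟙 (All.all? (λ y → ¬? (x Fin.≟ y)) (y ∷ u)) ∎
      where
      lem′ : ∀ a b c → a * (b * c) ≡ b * (a * c)
      lem′ = solve-∀

  distinct-punchIn : ∀ v (w : Vec (Fin n) m) → 𝟙 (distinct? (Vec.map (punchIn v) w)) ≡ 𝟙 (distinct? w)
  distinct-punchIn v w = 𝟙-cong (distinct? (Vec.map (punchIn v) w)) (distinct? w) (shrink w)
    (Unique.map⁺ (Fin.punchIn-injective v _ _))
    where
    shrink : ∀ {l} (u : Vec (Fin _) l) → Unique (Vec.map (punchIn v) u) → Unique u
    shrink []      _        = []
    shrink (x ∷ u) (p ∷ ps) = All.map (λ h e → h (cong (punchIn v) e)) (All.map⁻ p) ∷ shrink u ps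

  -- Records of words

  -- The same generalisation of `isRecord?` to words whose length and alphabet may differ.
  record? : (α : Fin m) (w : Vec (Fin N) m) →
            Dec (∀ α′ → α′ Fin.< α → lookup w α Fin.< lookup w α′)
  record? α w = Fin.all? (λ α′ → (α′ Fin.<? α) →-dec (lookup w α Fin.<? lookup w α′))

  lookup-∷ʳ-inject₁ : ∀ (w : Vec A m) v i → lookup (w ∷ʳ v) (inject₁ i) ≡ lookup w i
  lookup-∷ʳ-inject₁ (x ∷ w) v zero    = refl
  lookup-∷ʳ-inject₁ (x ∷ w) v (suc i) = lookup-∷ʳ-inject₁ w v i

  lookup-∷ʳ-fromℕ : ∀ (w : Vec A m) v → lookup (w ∷ʳ v) (fromℕ m) ≡ v
  lookup-∷ʳ-fromℕ []      v = refl
  lookup-∷ʳ-fromℕ (x ∷ w) v = lookup-∷ʳ-fromℕ w v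

  inject₁-<⁺ : ∀ {i j : Fin m} → i Fin.< j → inject₁ i Fin.< inject₁ j
  inject₁-<⁺ {i = i} {j} = subst₂ _<_ (sym (Fin.toℕ-inject₁ i)) (sym (Fin.toℕ-inject₁ j))

  inject₁-<⁻ : ∀ {i j : Fin m} → inject₁ i Fin.< inject₁ j → i Fin.< j
  inject₁-<⁻ {i = i} {j} = subst₂ _<_ (Fin.toℕ-inject₁ i) (Fin.toℕ-inject₁ j)

  punchIn-<⁺ : ∀ (v : Fin (suc n)) {i j} → i Fin.< j → punchIn v i Fin.< punchIn v j
  punchIn-<⁺ v {i} {j} i<j = ≰⇒> (λ h → <⇒≱ i<j (Fin.punchIn-cancel-≤ v j i h))

  punchIn-<⁻ : ∀ (v : Fin (suc n)) {i j} → punchIn v i Fin.< punchIn v j → i Fin.< j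
  punchIn-<⁻ v {i} {j} i<j = ≰⇒> (λ h → <⇒≱ i<j (Fin.punchIn-mono-≤ v j i h))

  -- A record is decided by the positions before it, so a letter appended at the end has no
  -- influence.
  record-∷ʳ : ∀ (w : Vec (Fin N) m) v α → 𝟙 (record? (inject₁ α) (w ∷ʳ v)) ≡ 𝟙 (record? α w)
  record-∷ʳ w v α = 𝟙-cong (record? (inject₁ α) (w ∷ʳ v)) (record? α w)
    (λ h i i<α → subst₂ Fin._<_ (lookup-∷ʳ-inject₁ w v α) (lookup-∷ʳ-inject₁ w v i)
                   (h (inject₁ i) (inject₁-<⁺ i<α)))
    extend
    where
    extend : (∀ i → i Fin.< α → lookup w α Fin.< lookup w i) →
             ∀ i → i Fin.< inject₁ α → lookup (w ∷ʳ v) (inject₁ α) Fin.< lookup (w ∷ʳ v) i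
    extend h i i<α with view i
    ... | ‵fromℕ     = contradiction i<α (<⇒≱ (subst₂ _<_ (sym (Fin.toℕ-inject₁ α)) (sym (Fin.toℕ-fromℕ _))
                         (Fin.toℕ<n α)) ∘ <⇒≤)
    ... | ‵inject₁ j = subst₂ Fin._<_ (sym (lookup-∷ʳ-inject₁ w v α)) (sym (lookup-∷ʳ-inject₁ w v j))
                         (h j (inject₁-<⁻ i<α))

  record-punchIn : ∀ v (w : Vec (Fin n) m) α → 𝟙 (record? α (Vec.map (punchIn v) w)) ≡ 𝟙 (record? α w)
  record-punchIn v w α = 𝟙-cong (record? α (Vec.map (punchIn v) w)) (record? α w)
    (λ h i i<α → punchIn-<⁻ v (subst₂ Fin._<_ (lookup-map α _ w) (lookup-map i _ w) (h i i<α)))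
    (λ h i i<α → subst₂ Fin._<_ (sym (lookup-map α _ w)) (sym (lookup-map i _ w)) (punchIn-<⁺ v (h i i<α)))

  -- Pigeonhole: punching out a missed value `x` would inject n + 1 positions into n values.
  injective⇒surjective : ∀ (w : Vec (Fin n) n) → Unique w → ∀ x → ¬ (∀ i → x ≢ lookup w i)
  injective⇒surjective {suc n} w u x h = 1+n≰n (Fin.injective⇒≤ {f = λ i → punchOut (h i)}
    (λ {i} {j} e → Unique.lookup-injective u i j (Fin.punchOut-injective (h i) (h j) e)))

  record-last : ∀ (v : Fin (suc n)) (w : Vec (Fin n) n) → Unique w →
                𝟙 (record? (fromℕ n) (Vec.map (punchIn v) w ∷ʳ v)) ≡ 𝟙 (v Fin.≟ zero)
  record-last {n} v w u = 𝟙-cong (record? (fromℕ n) W) (v Fin.≟ zero) (to v) (from v)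
    where
    W = Vec.map (punchIn v) w ∷ʳ v
    at-inject₁ : ∀ v i → lookup (Vec.map (punchIn v) w ∷ʳ v) (inject₁ i) ≡ punchIn v (lookup w i)
    at-inject₁ v i = trans (lookup-∷ʳ-inject₁ (Vec.map (punchIn v) w) v i) (lookup-map i (punchIn v) w)
    at-last : ∀ v → lookup (Vec.map (punchIn v) w ∷ʳ v) (fromℕ n) ≡ v
    at-last v = lookup-∷ʳ-fromℕ (Vec.map (punchIn v) w) v
    IsMin : Fin (suc n) → Set
    IsMin v = ∀ i → i Fin.< fromℕ n → lookup (Vec.map (punchIn v) w ∷ʳ v) (fromℕ n)
                                      Fin.< lookup (Vec.map (punchIn v) w ∷ʳ v) i
    to : ∀ v → IsMin v → v ≡ zero
    to zero             h = refl
    -- For nonzero `v`, `punchIn v` fixes zero, and the permutation `w` attains zero; an earlier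
    -- entry is then zero, and `v` cannot lie below it.
    to v@(suc {suc _} _) h = ⊥-elim (injective⇒surjective w u zero λ i e → n≮0
      (subst₂ Fin._<_ (at-last v) (trans (at-inject₁ v i) (cong (punchIn v) (sym e)))
        (h (inject₁ i) (subst₂ _<_ (sym (Fin.toℕ-inject₁ i)) (sym (Fin.toℕ-fromℕ _)) (Fin.toℕ<n i)))))
    from : ∀ v → v ≡ zero → IsMin v
    from .zero refl i i<n with view i
    ... | ‵fromℕ     = contradiction i<n (<-irrefl refl)
    ... | ‵inject₁ j = subst₂ Fin._<_ (sym (at-last zero)) (sym (at-inject₁ zero j)) (s≤s z≤n)

  -- The records of a uniformly random permutation are independent, position α
  -- (counted from 0) being a record with odds 1 : α.
  ∑-permutations : ∀ n (g : Fin n → ℕ → ℕ) →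
    ∑ (permutations n) (λ σ → ∏ n (λ α → g α (𝟙 (isRecord? α σ)))) ≡
    ∏ n (λ α → g α 1 + toℕ α * g α 0)
  ∑-permutations n g = trans (∑-filter unique? (words (allFin n) n) _) (go n g)
    where
    go : ∀ n (g : Fin n → ℕ → ℕ) →
      ∑ (words (allFin n) n) (λ σ → 𝟙 (distinct? σ) * ∏ n (λ α → g α (𝟙 (record? α σ)))) ≡
      ∏ n (λ α → g α 1 + toℕ α * g α 0)
    go zero    g = refl
    go (suc n) g = begin
      ∑ (words X (suc n)) (λ σ → 𝟙 (distinct? σ) * ∏ (suc n) (λ α → g α (𝟙 (record? α σ))))
        ≡⟨ ∑-words-∷ʳ X n _ ⟩
      ∑ X (λ v → ∑ (words X n) (λ w → 𝟙 (distinct? (w ∷ʳ v)) *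
                                     ∏ (suc n) (λ α → g α (𝟙 (record? α (w ∷ʳ v))))))
        ≡⟨ ∑-cong X (λ v → ∑-cong (words X n) (λ w → split v w)) ⟩
      ∑ X (λ v → ∑ (words X n) (λ w → avoids v w * F v w))
        ≡⟨ ∑-cong X (λ v → ∑-words-avoiding n n v (F v)) ⟩
      ∑ X (λ v → ∑ (words (allFin n) n) (λ w → F v (Vec.map (punchIn v) w)))
        ≡⟨ ∑-cong X (λ v → ∑-cong (words (allFin n) n) (λ w → relabel v w (distinct? w))) ⟩
      ∑ X (λ v → ∑ (words (allFin n) n) (λ w → G w * g (fromℕ n) (𝟙 (v Fin.≟ zero))))
        ≡⟨ ∑-cong X (λ v → ∑-*ʳ (words (allFin n) n) _ G) ⟩
      ∑ X (λ v → ∑ (words (allFin n) n) G * g (fromℕ n) (𝟙 (v Fin.≟ zero)))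
        ≡⟨ ∑-*ˡ X (∑ (words (allFin n) n) G) _ ⟩
      ∑ (words (allFin n) n) G * ∑ X (λ v → g (fromℕ n) (𝟙 (v Fin.≟ zero)))
        -- Among the n + 1 possible last values only zero makes the last position a record; the
        -- other n values give n times the non-record weight.
        ≡⟨ cong₂ _*_ (trans (go n (g ∘ inject₁))
             (∏-cong n (λ α → cong (λ l → g (inject₁ α) 1 + l * g (inject₁ α) 0) (sym (Fin.toℕ-inject₁ α)))))
             (trans (∑-allFin n _) (cong (g (fromℕ n) 1 +_)
               (trans (∑-const n (g (fromℕ n) 0)) (cong (_* g (fromℕ n) 0) (sym (Fin.toℕ-fromℕ n)))))) ⟩
      ∏ n (λ α → g (inject₁ α) 1 + toℕ (inject₁ α) * g (inject₁ α) 0) *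
        (g (fromℕ n) 1 + toℕ (fromℕ n) * g (fromℕ n) 0)
        ≡⟨ sym (∏-last n (λ α → g α 1 + toℕ α * g α 0)) ⟩
      ∏ (suc n) (λ α → g α 1 + toℕ α * g α 0) ∎
      where
      open ≡-Reasoning
      X = allFin (suc n)
      F : Fin (suc n) → Vec (Fin (suc n)) n → ℕ
      F v w = 𝟙 (distinct? w) * (∏ n (λ α → g (inject₁ α) (𝟙 (record? α w)))
                                * g (fromℕ n) (𝟙 (record? (fromℕ n) (w ∷ʳ v))))
      G : Vec (Fin n) n → ℕ
      G w = 𝟙 (distinct? w) * ∏ n (λ α → g (inject₁ α) (𝟙 (record? α w)))
      split : ∀ v w → 𝟙 (distinct? (w ∷ʳ v)) * ∏ (suc n) (λ α → g α (𝟙 (record? α (w ∷ʳ v))))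
                    ≡ avoids v w * F v w
      split v w = trans
        (cong₂ _*_ (distinct-∷ʳ w v) (trans (∏-last n (λ α → g α (𝟙 (record? α (w ∷ʳ v)))))
          (cong (_* g (fromℕ n) (𝟙 (record? (fromℕ n) (w ∷ʳ v))))
            (∏-cong n (λ α → cong (g (inject₁ α)) (record-∷ʳ w v α))))))
        (*-assoc (avoids v w) _ _)
      relabel : ∀ v w → Dec (Unique w) →
                F v (Vec.map (punchIn v) w) ≡ G w * g (fromℕ n) (𝟙 (v Fin.≟ zero))
      -- For a word with a repetition both sides vanish; the criterion for the last record is
      -- available only when `w` is a permutation.
      relabel v w (no ¬u) rewrite distinct-punchIn v w | 𝟙-no (distinct? w) ¬u = refl
      relabel v w (yes u) = trans
        (cong₂ _*_ (distinct-punchIn v w) (cong₂ _*_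
          (∏-cong n (λ α → cong (g (inject₁ α)) (record-punchIn v w α)))
          (cong (g (fromℕ n)) (record-last v w u))))
        (sym (*-assoc (𝟙 (distinct? w)) _ _))

  -- Record counts in a tuple of permutations

  -- steps k α h 0 = Σ (k choose β) α^(k-β) h β sums h over the number β of
  -- records at position α in k permutations.
  step : ℕ → (ℕ → ℕ) → ℕ → ℕ
  step α h l = h (suc l) + α * h l

  steps : ℕ → ℕ → (ℕ → ℕ) → ℕ → ℕ
  steps zero    α h = h
  steps (suc k) α h = steps k α (step α h)

  -- With the other permutations fixed, the first one only shifts each count by its own indicator,
  -- so `∑-permutations` applies and replaces every `h α` by `step (toℕ α) (h α)`.
  ∑-tuples : ∀ k n (h : Fin n → ℕ → ℕ) →
    ∑ (permutationTuples k n) (λ σs → ∏ n (λ α → h α (count (isRecord? α) σs))) ≡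
    ∏ n (λ α → steps k (toℕ α) (h α) 0)
  ∑-tuples zero    n h = +-identityʳ _
  ∑-tuples (suc k) n h = begin
    ∑ (permutationTuples (suc k) n) (λ σs → ∏ n (λ α → h α (count (isRecord? α) σs)))
      ≡⟨ ∑-words (permutations n) k _ ⟩
    ∑ (permutations n) (λ σ → ∑ (permutationTuples k n) (λ σs → ∏ n (λ α → h α (count (isRecord? α) (σ ∷ σs)))))
      ≡⟨ ∑-swap (permutations n) (permutationTuples k n) _ ⟩
    ∑ (permutationTuples k n) (λ σs → ∑ (permutations n) (λ σ → ∏ n (λ α → h α (count (isRecord? α) (σ ∷ σs)))))
      ≡⟨ ∑-cong (permutationTuples k n) (λ σs → trans
           (∑-cong (permutations n) (λ σ → ∏-cong n (λ α → cong (h α) (count-∷ (isRecord? α) σ σs))))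
           (∑-permutations n (λ α b → h α (b + count (isRecord? α) σs)))) ⟩
    ∑ (permutationTuples k n) (λ σs → ∏ n (λ α → step (toℕ α) (h α) (count (isRecord? α) σs)))
      ≡⟨ ∑-tuples k n (λ α → step (toℕ α) (h α)) ⟩
    ∏ n (λ α → steps (suc k) (toℕ α) (h α) 0) ∎
    where open ≡-Reasoning

  -- Linearity with the coefficient 2 that comes from 3^b = 1 + 2 b for an indicator b.
  steps-+ : ∀ k α (f g : ℕ → ℕ) l → steps k α (λ i → f i + 2 * g i) l ≡ steps k α f l + 2 * steps k α g l
  steps-cong : ∀ k α {f g : ℕ → ℕ} → (∀ i → f i ≡ g i) → ∀ l → steps k α f l ≡ steps k α g l

  steps-cong zero    α h l = h l
  steps-cong (suc k) α h l = steps-cong k α (λ i → cong₂ (λ x y → x + α * y) (h (suc i)) (h i)) l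

  steps-+ zero    α f g l = refl
  steps-+ (suc k) α f g l = trans
    (steps-cong k α (λ i → lem α (f (suc i)) (g (suc i)) (f i) (g i)) l)
    (steps-+ k α (step α f) (step α g) l)
    where
    lem : ∀ α a b c d → a + 2 * b + α * (c + 2 * d) ≡ a + α * c + 2 * (b + α * d)
    lem = solve-∀

  steps-const : ∀ k α c l → steps k α (λ _ → c) l ≡ c * suc α ^ k
  steps-const zero    α c l = sym (*-identityʳ c)
  steps-const (suc k) α c l = trans (steps-const k α (c + α * c) l) (lem α c (suc α ^ k))
    where
    lem : ∀ α c p → (c + α * c) * p ≡ c * ((1 + α) * p)
    lem = solve-∀

  -- In the term with β records the k - β non-record factors α are enlarged to α + 1 and join the (α
  -- + 1)^β of the hypothesis. The power (α + 1)^k then comes out and a plain binomial sum remains.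
  -- The parameter `y` accumulates these factors along the induction.
  steps-≤ : ∀ k α x y (f g : ℕ → ℕ) → (∀ i → x * f i ≤ suc α ^ i * y * g i) →
            x * steps k α f 0 ≤ suc α ^ k * y * steps k 1 g 0
  steps-≤ zero    α x y f g h = h 0
  steps-≤ (suc k) α x y f g h = ≤-trans (steps-≤ k α x (suc α * y) (step α f) (step 1 g) bound)
    (≤-reflexive (cong (_* steps k 1 (step 1 g) 0) (lem₀ (suc α) (suc α ^ k) y)))
    where
    open ≤-Reasoning
    lem₀ : ∀ a p y → p * (a * y) ≡ a * p * y
    lem₀ = solve-∀
    lem₁ : ∀ x α a b → x * (a + α * b) ≡ x * a + α * (x * b)
    lem₁ = solve-∀
    lem₂ : ∀ s p y a b → s * p * y * a + s * (p * y * b) ≡ p * (s * y) * (a + 1 * b)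
    lem₂ = solve-∀
    bound : ∀ i → x * step α f i ≤ suc α ^ i * (suc α * y) * step 1 g i
    bound i = begin
      x * (f (suc i) + α * f i)         ≡⟨ lem₁ x α (f (suc i)) (f i) ⟩
      x * f (suc i) + α * (x * f i)     ≤⟨ +-mono-≤ (h (suc i)) (*-mono-≤ (n≤1+n α) (h i)) ⟩
      suc α ^ suc i * y * g (suc i) + suc α * (suc α ^ i * y * g i)
        ≡⟨ lem₂ (suc α) (suc α ^ i) y (g (suc i)) (g i) ⟩
      suc α ^ i * (suc α * y) * step 1 g i ∎

  -- Pascal's rule: with α = 1 each step adds neighbouring values of `h`. Any range beyond k is
  -- allowed because the further binomial coefficients are zero.
  steps-binomial : ∀ k n (h : ℕ → ℕ) l → k < n →
                   steps k 1 h l ≡ ∑ (allFin n) (λ β → (k C toℕ β) * h (l + toℕ β))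
  steps-binomial zero    (suc n) h l _ = sym (trans (∑-allFin n (λ β → (0 C toℕ β) * h (l + toℕ β)))
    (trans (cong₂ _+_ (trans (+-identityʳ _) (cong h (+-identityʳ l)))
                      (trans (∑-cong (allFin n) (λ β → cong (_* h (l + suc (toℕ β)))
                               (k>n⇒nCk≡0 {0} {suc (toℕ β)} (s≤s z≤n))))
                             (∑-zero (allFin n))))
           (+-identityʳ (h l))))
  steps-binomial (suc k) (suc n) h l (s≤s k<n) = begin
    steps k 1 (step 1 h) l
      ≡⟨ steps-cong k 1 (λ i → lem₀ (h (suc i)) (h i)) l ⟩
    steps k 1 (λ i → h i + h (suc i)) l
      ≡⟨ trans (steps-binomial k n (λ i → h i + h (suc i)) l k<n)
           (trans (∑-cong X (λ β → *-distribˡ-+ (k C toℕ β) _ _)) (∑-+ X _ _)) ⟩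
    ∑ X (λ β → (k C toℕ β) * h (l + toℕ β)) + ∑ X (λ β → (k C toℕ β) * h (suc (l + toℕ β)))
      ≡⟨ cong (_+ ∑ X (λ β → (k C toℕ β) * h (suc (l + toℕ β))))
           -- The same value is expanded over n terms and over n + 1 terms; the longer expansion can
           -- split off its first term.
           (trans (sym (steps-binomial k n h l k<n)) (trans (steps-binomial k (suc n) h l (m<n⇒m<1+n k<n))
             (∑-allFin n (λ β → (k C toℕ β) * h (l + toℕ β))))) ⟩
    (k C 0) * h (l + 0) + ∑ X (λ β → (k C suc (toℕ β)) * h (l + suc (toℕ β)))
        + ∑ X (λ β → (k C toℕ β) * h (suc (l + toℕ β)))
      ≡⟨ +-assoc ((k C 0) * h (l + 0)) _ _ ⟩
    (k C 0) * h (l + 0) + (∑ X (λ β → (k C suc (toℕ β)) * h (l + suc (toℕ β)))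
        + ∑ X (λ β → (k C toℕ β) * h (suc (l + toℕ β))))
      ≡⟨ cong₂ _+_ (cong (_* h (l + 0)) (trans (nC0≡1 k) (sym (nC0≡1 (suc k)))))
           (trans (sym (∑-+ X _ _)) (∑-cong X pascal)) ⟩
    (suc k C 0) * h (l + 0) + ∑ X (λ β → (suc k C suc (toℕ β)) * h (l + suc (toℕ β)))
      ≡⟨ sym (∑-allFin n (λ β → (suc k C toℕ β) * h (l + toℕ β))) ⟩
    ∑ (allFin (suc n)) (λ β → (suc k C toℕ β) * h (l + toℕ β)) ∎
    where
    open ≡-Reasoning
    X = allFin n
    nC0≡1 : ∀ n → n C 0 ≡ 1
    nC0≡1 n = trans (nCk≡nC[n∸k] {0} {n} z≤n) (nCn≡1 n)
    lem₀ : ∀ a b → a + 1 * b ≡ b + a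
    lem₀ = solve-∀
    pascal : ∀ β → (k C suc (toℕ β)) * h (l + suc (toℕ β)) + (k C toℕ β) * h (suc (l + toℕ β))
           ≡ (suc k C suc (toℕ β)) * h (l + suc (toℕ β))
    pascal β rewrite +-suc l (toℕ β) = trans (sym (*-distribʳ-+ (h (suc (l + toℕ β))) (k C suc (toℕ β)) _))
      (cong (_* h (suc (l + toℕ β))) (trans (+-comm (k C suc (toℕ β)) _) (nCk+nC[k+1]≡[n+1]C[k+1] k (toℕ β))))

  -- Junk value 0 beyond the end of the vector.
  at : Vec (Fin 2) m → ℕ → ℕ
  at []      _       = 0
  at (x ∷ c) zero    = toℕ x
  at (x ∷ c) (suc i) = at c i

  at-toℕ : ∀ (c : Vec (Fin 2) m) i → at c (toℕ i) ≡ toℕ (lookup c i)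
  at-toℕ (x ∷ c) zero    = refl
  at-toℕ (x ∷ c) (suc i) = at-toℕ c i

  -- Over (α + 1)^k, steps k α (at c) 0 is the probability that the position α
  -- (counted from 0) lies in the optimization set.
  selection-bound : ∀ k α (c : Vec (Fin 2) (suc (suc k))) → lookup c zero ≡ zero →
    suc α ^ 2 * steps (suc k) α (at c) 0 ≤
    suc α ^ suc k * (suc k * at c 1 * suc α + binomialSum c)
  selection-bound k α c c₀≡0 = ≤-trans
    (steps-≤ (suc k) α (suc α ^ 2) 1 (at c) g bound)
    (≤-reflexive (cong₂ _*_ (*-identityʳ (suc α ^ suc k)) sum-g))
    where
    -- Clearing the denominator (α + 1)² leaves a factor α + 1 on the one-record term and at most 1
    -- on the terms with two or more records; the term without records is excluded by c₀ = 0.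
    g : ℕ → ℕ
    g zero          = 0
    g (suc zero)    = suc α * at c 1
    g (suc (suc i)) = at c (suc (suc i))
    bound : ∀ i → suc α ^ 2 * at c i ≤ suc α ^ i * 1 * g i
    bound zero = ≤-reflexive (trans (cong (suc α ^ 2 *_) (trans (at-toℕ c zero) (cong toℕ c₀≡0)))
      (*-zeroʳ (suc α ^ 2)))
    bound (suc zero) = ≤-reflexive (lem (suc α) (at c 1))
      where
      lem : ∀ a x → a * (a * 1) * x ≡ a * 1 * 1 * (a * x)
      lem = solve-∀
    bound (suc (suc i)) = *-monoˡ-≤ (at c (suc (suc i)))
      (≤-trans (^-monoʳ-≤ (suc α) (s≤s (s≤s (z≤n {i})))) (≤-reflexive (sym (*-identityʳ _))))
    X = allFin k
    sum-g : steps (suc k) 1 g 0 ≡ suc k * at c 1 * suc α + binomialSum c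
    sum-g = begin
      steps (suc k) 1 g 0
        ≡⟨ steps-binomial (suc k) (suc (suc k)) g 0 ≤-refl ⟩
      ∑ (allFin (suc (suc k))) (λ β → (suc k C toℕ β) * g (toℕ β))
        ≡⟨ trans (∑-allFin (suc k) (λ β → (suc k C toℕ β) * g (toℕ β)))
             (cong₂ _+_ (*-zeroʳ (suc k C 0)) (∑-allFin k (λ β → (suc k C suc (toℕ β)) * g (suc (toℕ β))))) ⟩
      (suc k C 1) * (suc α * at c 1) + ∑ X (λ β → (suc k C suc (suc (toℕ β))) * at c (suc (suc (toℕ β))))
        ≡⟨ cong₂ _+_ (trans (cong (_* (suc α * at c 1)) (nC1≡n (suc k))) (lem (suc k) (suc α) (at c 1)))
             (∑-cong X (λ β → trans (*-comm (suc k C suc (suc (toℕ β))) _)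
               (trans (cong (_* (suc k C suc (suc (toℕ β)))) (at-toℕ c (suc (suc β))))
                      (sym (+-identityʳ _))))) ⟩
      suc k * at c 1 * suc α + ∑ X (λ β → f (suc (suc β)))
        ≡⟨ cong (suc k * at c 1 * suc α +_) (sym (trans (∑-allFin (suc k) f) (∑-allFin k (f ∘ suc)))) ⟩
      suc k * at c 1 * suc α + ∑ (allFin (suc (suc k))) f
        ≡⟨ cong (suc k * at c 1 * suc α +_) (sym (∑-filter (λ β → 2 ≤? toℕ β) (allFin (suc (suc k))) _)) ⟩
      suc k * at c 1 * suc α + binomialSum c ∎
      where
      open ≡-Reasoning
      lem : ∀ k a x → k * (a * x) ≡ k * x * a
      lem = solve-∀
      f : Fin (suc (suc k)) → ℕ
      f β = 𝟙 (2 ≤? toℕ β) * (toℕ (lookup c β) * (suc k C toℕ β))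

  -- The generating function of the weight

  card-∷ : ∀ b (p : Subset n) → card (b ∷ p) ≡ bit b + card p
  card-∷ true  p = refl
  card-∷ false p = refl

  card-tabulate-^ : ∀ n b (f : Fin n → Bool) → suc b ^ card (Vec.tabulate f) ≡ ∏ n (λ i → 1 + b * bit (f i))
  card-tabulate-^ zero    b f = refl
  card-tabulate-^ (suc n) b f with f zero
  ... | true  = cong₂ _*_ (cong suc (sym (*-identityʳ b))) (card-tabulate-^ n b (f ∘ suc))
  ... | false = trans (card-tabulate-^ n b (f ∘ suc)) (trans (sym (*-identityˡ _))
      (cong (_* ∏ n (λ i → 1 + b * bit (f (suc i)))) (cong suc (sym (*-zeroʳ b)))))

  card-tabulate-+ : ∀ n (f g : Fin n → Bool) → (∀ i → bit (f i) + bit (g i) ≡ 1) →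
                    card (Vec.tabulate f) + card (Vec.tabulate g) ≡ n
  card-tabulate-+ zero    f g h = refl
  card-tabulate-+ (suc n) f g h
    rewrite card-∷ (f zero) (Vec.tabulate (f ∘ suc)) | card-∷ (g zero) (Vec.tabulate (g ∘ suc)) =
    trans (lem (bit (f zero)) _ (bit (g zero)) _)
          (cong₂ _+_ (h zero) (card-tabulate-+ n (f ∘ suc) (g ∘ suc) (h ∘ suc)))
    where
    lem : ∀ a b c d → a + b + (c + d) ≡ (a + c) + (b + d)
    lem = solve-∀

  bit-≟1 : ∀ (x : Fin 2) → 𝟙 (x Fin.≟ suc zero) ≡ toℕ x
  bit-≟1 zero       = refl
  bit-≟1 (suc zero) = refl

  -- The weight without the first position, which always has l = k.
  restWeight : ∀ {k n} → Vec (Fin 2) (suc k) → Vec (Vec (Fin (suc n)) (suc n)) k → ℕ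
  restWeight c σs = card (Vec.tabulate λ α → does (lookup c (recordCount σs (suc α)) Fin.≟ suc zero))

  weight≡ : ∀ {k n} (c : Vec (Fin 2) (suc k)) (σs : Vec (Vec (Fin (suc n)) (suc n)) k) →
            weight c σs ≡ toℕ (lookup c (fromℕ k)) + restWeight c σs
  weight≡ {k} {n} c σs = trans
    (card-∷ (does (lookup c (recordCount σs zero) Fin.≟ suc zero))
            (Vec.tabulate λ α → does (lookup c (recordCount σs (suc α)) Fin.≟ suc zero)))
    (cong (_+ restWeight c σs) (trans (bit-≟1 (lookup c (recordCount σs zero)))
      (cong (λ r → toℕ (lookup c r)) (Fin.toℕ-injective
        (trans (Fin.toℕ-fromℕ< _) (trans (all-records σs) (sym (Fin.toℕ-fromℕ k))))))))
    where
    all-records : ∀ {j} (σs : Vec (Vec (Fin (suc n)) (suc n)) j) → count (isRecord? zero) σs ≡ j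
    all-records []       = refl
    all-records (σ ∷ σs) = trans (count-∷ (isRecord? zero) σ σs)
      (cong₂ _+_ (𝟙-yes (isRecord? zero σ) (λ _ ())) (all-records σs))

  restWeight-complement : ∀ {k n} (c : Vec (Fin 2) (suc k)) (σs : Vec (Vec (Fin (suc n)) (suc n)) k) →
                          restWeight c σs + restWeight (complement c) σs ≡ n
  restWeight-complement {n = n} c σs = card-tabulate-+ n _ _ λ α →
    let r = recordCount σs (suc α) in
    trans (cong (λ x → 𝟙 (lookup c r Fin.≟ suc zero) + 𝟙 (x Fin.≟ suc zero)) (lookup-map r Fin.opposite c))
          (lem (lookup c r))
    where
    lem : ∀ (x : Fin 2) → 𝟙 (x Fin.≟ suc zero) + 𝟙 (Fin.opposite x Fin.≟ suc zero) ≡ 1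
    lem zero       = refl
    lem (suc zero) = refl

  ∑-restWeight : ∀ k n (c : Vec (Fin 2) (suc k)) →
    ∑ (permutationTuples k (suc n)) (λ σs → 3 ^ restWeight c σs) ≡
    ∏ n (λ α → suc (suc (toℕ α)) ^ k + 2 * steps k (suc (toℕ α)) (at c) 0)
  ∑-restWeight k n c = begin
    ∑ (permutationTuples k (suc n)) (λ σs → 3 ^ restWeight c σs)
      ≡⟨ ∑-cong (permutationTuples k (suc n)) (λ σs → trans (card-tabulate-^ n 2 _)
           (trans (∏-cong n (λ α → cong (λ b → 1 + 2 * b) (bit-at σs α))) (sym (*-identityˡ _)))) ⟩
    ∑ (permutationTuples k (suc n)) (λ σs → ∏ (suc n) (λ α → h α (count (isRecord? α) σs)))
      ≡⟨ ∑-tuples k (suc n) h ⟩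
    steps k 0 (λ _ → 1) 0 * ∏ n (λ α → steps k (suc (toℕ α)) (λ l → 1 + 2 * at c l) 0)
      ≡⟨ cong₂ _*_ (trans (steps-const k 0 1 0) (trans (*-identityˡ (1 ^ k)) (^-zeroˡ k)))
           (∏-cong n (λ α → trans (steps-+ k (suc (toℕ α)) (λ _ → 1) (at c) 0)
             (cong (_+ 2 * steps k (suc (toℕ α)) (at c) 0)
               (trans (steps-const k (suc (toℕ α)) 1 0) (*-identityˡ _))))) ⟩
    1 * ∏ n (λ α → suc (suc (toℕ α)) ^ k + 2 * steps k (suc (toℕ α)) (at c) 0)
      ≡⟨ *-identityˡ _ ⟩
    ∏ n (λ α → suc (suc (toℕ α)) ^ k + 2 * steps k (suc (toℕ α)) (at c) 0) ∎
    where
    open ≡-Reasoning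
    h : Fin (suc n) → ℕ → ℕ
    -- The constant 1 leaves the first position out of the weight; its factor in the product is 1^k.
    h zero    l = 1
    h (suc α) l = 1 + 2 * at c l
    bit-at : ∀ σs α → 𝟙 (lookup c (recordCount σs (suc α)) Fin.≟ suc zero) ≡ at c (count (isRecord? (suc α)) σs)
    bit-at σs α = trans (bit-≟1 _) (trans (sym (at-toℕ c (recordCount σs (suc α))))
      (cong (at c) (Fin.toℕ-fromℕ< _)))

  ^-distribʳ-* : ∀ k m n → (m * n) ^ k ≡ m ^ k * n ^ k
  ^-distribʳ-* zero    m n = refl
  ^-distribʳ-* (suc k) m n = trans (cong (m * n *_) (^-distribʳ-* k m n)) (lem m n (m ^ k) (n ^ k))
    where
    lem : ∀ m n p q → m * n * (p * q) ≡ m * p * (n * q)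
    lem = solve-∀

  factorial-^ : ∀ n k → (suc n !) ^ k ≡ ∏ n (λ α → suc (suc (toℕ α)) ^ k)
  factorial-^ zero    k = ^-zeroˡ k
  factorial-^ (suc n) k = begin
    (suc (suc n) * (suc n !)) ^ k             ≡⟨ ^-distribʳ-* k (suc (suc n)) (suc n !) ⟩
    suc (suc n) ^ k * (suc n !) ^ k           ≡⟨ *-comm (suc (suc n) ^ k) _ ⟩
    (suc n !) ^ k * suc (suc n) ^ k           ≡⟨ cong₂ _*_ (trans (factorial-^ n k)
                                                 (∏-cong n (λ α → cong (λ l → suc (suc l) ^ k) (sym (Fin.toℕ-inject₁ α)))))
                                                 (cong (λ l → suc (suc l) ^ k) (sym (Fin.toℕ-fromℕ n))) ⟩
    ∏ n (λ α → suc (suc (toℕ (inject₁ α))) ^ k) * suc (suc (toℕ (fromℕ n))) ^ k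
                                            ≡⟨ sym (∏-last n (λ α → suc (suc (toℕ α)) ^ k)) ⟩
    ∏ (suc n) (λ α → suc (suc (toℕ α)) ^ k) ∎
    where open ≡-Reasoning

  -- Markov's inequality for counts

  Σℕ : ℕ → (ℕ → ℕ) → ℕ
  Σℕ zero    f = 0
  Σℕ (suc n) f = Σℕ n f + f n

  Σℕ-cong : ∀ n {f g} → (∀ i → f i ≡ g i) → Σℕ n f ≡ Σℕ n g
  Σℕ-cong zero    h = refl
  Σℕ-cong (suc n) h = cong₂ _+_ (Σℕ-cong n h) (h n)

  Σℕ-∑ : ∀ n (xs : List A) (f : ℕ → A → ℕ) → Σℕ n (λ i → ∑ xs (f i)) ≡ ∑ xs (λ x → Σℕ n (λ i → f i x))
  Σℕ-∑ zero    xs f = sym (∑-zero xs)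
  Σℕ-∑ (suc n) xs f = trans (cong (_+ ∑ xs (f n)) (Σℕ-∑ n xs f)) (sym (∑-+ xs _ (f n)))

  -- The values b + i are distinct, so a tuple is counted for at most one of the weights in the
  -- range.
  Σℕ-hit : ∀ n x b → Σℕ n (λ i → 𝟙 (ℤ.+ x ℤ.≟ ℤ.+ (b + i))) ≡ 0 ⊎
           (Σℕ n (λ i → 𝟙 (ℤ.+ x ℤ.≟ ℤ.+ (b + i))) ≡ 1 × ∃ λ i → i < n × x ≡ b + i)
  Σℕ-hit zero    x b = inj₁ refl
  Σℕ-hit (suc n) x b with ℤ.+ x ℤ.≟ ℤ.+ (b + n) | Σℕ-hit n x b
  ... | yes e | inj₁ h = inj₂ (cong₂ _+_ h (𝟙-yes (ℤ.+ x ℤ.≟ ℤ.+ (b + n)) e) , n , ≤-refl , ℤ.+-injective e)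
  ... | yes e | inj₂ (_ , i , i<n , e′) = contradiction (+-cancelˡ-≡ b i n (trans (sym e′) (ℤ.+-injective e))) (<⇒≢ i<n)
  ... | no ¬e | inj₁ h = inj₁ (cong₂ _+_ h (𝟙-no (ℤ.+ x ℤ.≟ ℤ.+ (b + n)) ¬e))
  ... | no ¬e | inj₂ (h , i , i<n , e′) =
    inj₂ (cong₂ _+_ h (𝟙-no (ℤ.+ x ℤ.≟ ℤ.+ (b + n)) ¬e) , i , m<n⇒m<1+n i<n , e′)

  -- Every tuple counted on the left is counted once and has 3^M ≤ 3^Y. The statistic `Y` is kept
  -- separate from the weight because small weights are large values of the complementary weight.
  markov : ∀ {k n} (c : Vec (Fin 2) (suc k)) (Y : Vec (Vec (Fin n) n) k → ℕ)
    M len (v : ℕ → ℤ) b →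
    (∀ i → v i ≡ ℤ.+ (b + i)) →
    (∀ σs i → i < len → weight c σs ≡ b + i → M ≤ Y σs) →
    Σℕ len (λ i → O c n (v i)) * 3 ^ M ≤ ∑ (permutationTuples k n) (λ σs → 3 ^ Y σs)
  markov {k} {n} c Y M len v b hv hY = begin
    Σℕ len (λ i → O c n (v i)) * 3 ^ M
      ≡⟨ cong (_* 3 ^ M) (trans (Σℕ-cong len (λ i → trans (cong (O c n) (hv i))
           (length-filter (λ σs → ℤ.+ weight c σs ℤ.≟ ℤ.+ (b + i)) T)))
           (Σℕ-∑ len T (λ i σs → 𝟙 (ℤ.+ weight c σs ℤ.≟ ℤ.+ (b + i))))) ⟩
    ∑ T (λ σs → Σℕ len (λ i → 𝟙 (ℤ.+ weight c σs ℤ.≟ ℤ.+ (b + i)))) * 3 ^ M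
      ≡⟨ sym (∑-*ʳ T (3 ^ M) _) ⟩
    ∑ T (λ σs → Σℕ len (λ i → 𝟙 (ℤ.+ weight c σs ℤ.≟ ℤ.+ (b + i))) * 3 ^ M)
      ≤⟨ ∑-mono T pointwise ⟩
    ∑ T (λ σs → 3 ^ Y σs) ∎
    where
    open ≤-Reasoning
    T = permutationTuples k n
    pointwise : ∀ σs → Σℕ len (λ i → 𝟙 (ℤ.+ weight c σs ℤ.≟ ℤ.+ (b + i))) * 3 ^ M ≤ 3 ^ Y σs
    pointwise σs with Σℕ-hit len (weight c σs) b
    ... | inj₁ h                = ≤-trans (≤-reflexive (cong (_* 3 ^ M) h)) z≤n
    ... | inj₂ (h , i , i<l , e) = ≤-trans (≤-reflexive (trans (cong (_* 3 ^ M) h) (*-identityˡ _)))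
      (^-monoʳ-≤ 3 {M} {Y σs} (hY σs i i<l e))

module Exponential where
  open import Data.Integer.Base using (+_)
  open import Data.Rational
    using (ℚ; _+_; _*_; _-_; -_; _≤_; _<_; _/_; ∣_∣; 0ℚ; 1ℚ)
  open import Data.Rational.Properties
  open import Data.Rational.Solver using (module +-*-Solver)
  open +-*-Solver

  private
    variable
      p q x y : ℚ

  -- Rational casts and sums

  0≤∑ : 0ℚ ≤ p → 0ℚ ≤ q → 0ℚ ≤ p + q
  0≤∑ hp hq = cast (+-identityʳ 0ℚ) refl (hp ⊕ hq)

  ι : ℕ → ℚ
  ι n = + n / 1

  ι-+ : ∀ m n → ι (m ℕ.+ n) ≡ ι m + ι n
  ι-+ m n = sym (frac-+ m n 0)

  ι-* : ∀ m n → ι (m ℕ.* n) ≡ ι m * ι n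
  ι-* m n = sym (frac-* m n 0 0)

  0≤ι : ∀ n → 0ℚ ≤ ι n
  0≤ι n = frac-nonNeg n 0

  ι-mono : ∀ {m n} → m ℕ.≤ n → ι m ≤ ι n
  ι-mono {m} {n} h = frac-≤ {m} {0} {n} {0} (ℕ.*-monoˡ-≤ 1 h)

  ι-*-1/ : ∀ n → ι (suc n) * (+ 1 / suc n) ≡ 1ℚ
  ι-*-1/ n = trans (frac-* (suc n) 1 0 n)
    (frac-≡ {suc n ℕ.* 1} {n ℕ.+ 0} {1} {0} (trans (ℕ.*-identityʳ _)
      (trans (ℕ.*-identityʳ (suc n)) (trans (cong suc (sym (ℕ.+-identityʳ n))) (sym (ℕ.*-identityˡ _))))))

  Σ-nonNeg : ∀ n {f} → (∀ i → 0ℚ ≤ f i) → 0ℚ ≤ Σ< n f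
  Σ-nonNeg zero    h = ≤-refl
  Σ-nonNeg (suc n) h = 0≤∑ (Σ-nonNeg n h) (h n)

  Σ-grow : ∀ {m n f} → (∀ i → 0ℚ ≤ f i) → m ℕ.≤ n → Σ< m f ≤ Σ< n f
  Σ-grow {m} {n} {f} h m≤n = subst (λ l → Σ< m f ≤ Σ< l f) (ℕ.m+[n∸m]≡n m≤n)
    (≤-trans (p≤p+q (Σ-nonNeg (n ℕ.∸ m) (λ i → h (m ℕ.+ i)))) (≤-reflexive (sym (Σ-split m (n ℕ.∸ m) f))))

  Σ-first : ∀ n f → Σ< (suc n) f ≡ f 0 + Σ< n (f ∘ suc)
  Σ-first zero    f = +-comm 0ℚ (f 0)
  Σ-first (suc n) f = trans (cong (_+ f (suc n)) (Σ-first n f)) (+-assoc (f 0) _ _)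

  ∣Σ∣≤ : ∀ n f → ∣ Σ< n f ∣ ≤ Σ< n (λ i → ∣ f i ∣)
  ∣Σ∣≤ zero    f = ≤-refl
  ∣Σ∣≤ (suc n) f = ≤-trans (∣p+q∣≤∣p∣+∣q∣ (Σ< n f) (f n)) (∣Σ∣≤ n f ⊕ ≤-refl)

  Σ-* : ∀ n c f → Σ< n (λ i → c * f i) ≡ c * Σ< n f
  Σ-* zero    c f = sym (*-zeroʳ c)
  Σ-* (suc n) c f = trans (cong (_+ c * f n) (Σ-* n c f)) (sym (*-distribˡ-+ c (Σ< n f) (f n)))

  Σ-+ : ∀ n f g → Σ< n (λ i → f i + g i) ≡ Σ< n f + Σ< n g
  Σ-+ zero    f g = sym (+-identityʳ 0ℚ)
  Σ-+ (suc n) f g = trans (cong (_+ (f n + g n)) (Σ-+ n f g))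
    (solve 4 (λ a b c d → a :+ b :+ (c :+ d) := a :+ c :+ (b :+ d)) refl (Σ< n f) (Σ< n g) (f n) (g n))

  -- Cauchy products

  conv : (ℕ → ℚ) → (ℕ → ℚ) → ℕ → ℚ
  conv f g zero    = f 0 * g 0
  conv f g (suc n) = f 0 * g (suc n) + conv (f ∘ suc) g n

  conv-cong : ∀ n {f f′ g g′} → (∀ i → f i ≡ f′ i) → (∀ i → g i ≡ g′ i) → conv f g n ≡ conv f′ g′ n
  conv-cong zero    hf hg = cong₂ _*_ (hf 0) (hg 0)
  conv-cong (suc n) hf hg = cong₂ _+_ (cong₂ _*_ (hf 0) (hg (suc n))) (conv-cong n (hf ∘ suc) hg)

  conv-+ˡ : ∀ n f f′ g → conv (λ i → f i + f′ i) g n ≡ conv f g n + conv f′ g n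
  conv-+ˡ zero    f f′ g = *-distribʳ-+ (g 0) (f 0) (f′ 0)
  conv-+ˡ (suc n) f f′ g = trans (cong (_+_ ((f 0 + f′ 0) * g (suc n))) (conv-+ˡ n (f ∘ suc) (f′ ∘ suc) g))
    (solve 5 (λ a b c d e → (a :+ b) :* c :+ (d :+ e) := a :* c :+ d :+ (b :* c :+ e)) refl
       (f 0) (f′ 0) (g (suc n)) (conv (f ∘ suc) g n) (conv (f′ ∘ suc) g n))

  conv-*ˡ : ∀ n c f g → conv (λ i → c * f i) g n ≡ c * conv f g n
  conv-*ˡ zero    c f g = *-assoc c (f 0) (g 0)
  conv-*ˡ (suc n) c f g = trans (cong (_+_ (c * f 0 * g (suc n))) (conv-*ˡ n c (f ∘ suc) g))
    (solve 4 (λ c a b d → c :* a :* b :+ c :* d := c :* (a :* b :+ d)) refl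
       c (f 0) (g (suc n)) (conv (f ∘ suc) g n))

  conv-*ʳ : ∀ n c f g → conv f (λ i → c * g i) n ≡ c * conv f g n
  conv-*ʳ zero    c f g = solve 3 (λ c a b → a :* (c :* b) := c :* (a :* b)) refl c (f 0) (g 0)
  conv-*ʳ (suc n) c f g = trans (cong (_+_ (f 0 * (c * g (suc n)))) (conv-*ʳ n c (f ∘ suc) g))
    (solve 4 (λ c a b d → a :* (c :* b) :+ c :* d := c :* (a :* b :+ d)) refl
       c (f 0) (g (suc n)) (conv (f ∘ suc) g n))

  conv-last : ∀ n f g → conv f g (suc n) ≡ conv f (g ∘ suc) n + f (suc n) * g 0
  conv-last zero    f g = refl
  conv-last (suc n) f g = trans (cong (_+_ (f 0 * g (suc (suc n)))) (conv-last n (f ∘ suc) g))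
    (sym (+-assoc (f 0 * g (suc (suc n))) _ _))

  -- The coefficients of z F′(z), where F is the power series with coefficients `f`; `leibniz` is
  -- the product rule for this derivation.
  weighted : (ℕ → ℚ) → ℕ → ℚ
  weighted f i = ι i * f i

  leibniz : ∀ n f g → ι n * conv f g n ≡ conv (weighted f) g n + conv f (weighted g) n
  leibniz zero    f g = solve 2 (λ a b → con 0ℚ :* (a :* b) := con 0ℚ :* a :* b :+ a :* (con 0ℚ :* b)) refl (f 0) (g 0)
  leibniz (suc n) f g = begin
    ι (suc n) * (f 0 * g (suc n) + C)
      ≡⟨ solve 4 (λ i a b c → i :* (a :* b :+ c) := a :* (i :* b) :+ i :* c) refl (ι (suc n)) (f 0) (g (suc n)) C ⟩
    f 0 * weighted g (suc n) + ι (suc n) * C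
      ≡⟨ cong (_+_ (f 0 * weighted g (suc n))) (trans (cong (_* C) (ι-+ 1 n))
           (trans (solve 2 (λ i c → (con 1ℚ :+ i) :* c := c :+ i :* c) refl (ι n) C)
                  (cong (_+_ C) (leibniz n (f ∘ suc) g)))) ⟩
    f 0 * weighted g (suc n) + (C + (conv (weighted (f ∘ suc)) g n + conv (f ∘ suc) (weighted g) n))
      ≡⟨ solve 6 (λ a b c d e z → b :+ (c :+ (d :+ e)) := con 0ℚ :* a :* z :+ (c :+ d) :+ (b :+ e)) refl
           (f 0) (f 0 * weighted g (suc n)) C (conv (weighted (f ∘ suc)) g n) (conv (f ∘ suc) (weighted g) n) (g (suc n)) ⟩
    ι 0 * f 0 * g (suc n) + (C + conv (weighted (f ∘ suc)) g n) + conv f (weighted g) (suc n)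
      ≡⟨ cong (λ c → ι 0 * f 0 * g (suc n) + c + conv f (weighted g) (suc n))
           (trans (sym (conv-+ˡ n (f ∘ suc) (weighted (f ∘ suc)) g))
             (conv-cong n (λ i → trans (solve 2 (λ i a → a :+ i :* a := (con 1ℚ :+ i) :* a) refl (ι i) (f (suc i)))
                                       (cong (_* f (suc i)) (sym (ι-+ 1 i)))) (λ _ → refl))) ⟩
    conv (weighted f) g (suc n) + conv f (weighted g) (suc n) ∎
    where
    open ≡-Reasoning
    C = conv (f ∘ suc) g n

  weighted-expTerm : ∀ x i → weighted (expTerm x) (suc i) ≡ x * expTerm x i
  weighted-expTerm x i = trans
    (solve 4 (λ n t x r → n :* (t :* (x :* r)) := n :* r :* (x :* t)) refl (ι (suc i)) (expTerm x i) x (+ 1 / suc i))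
    (trans (cong (_* (x * expTerm x i)) (ι-*-1/ i)) (*-identityˡ _))

  -- The product rule gives (n + 1) C (n + 1) = (x + y) C n for the coefficients C of the product,
  -- which is the recursion of `expTerm (x + y)`.
  conv-expTerm : ∀ x y n → conv (expTerm x) (expTerm y) n ≡ expTerm (x + y) n
  conv-expTerm x y zero    = refl
  conv-expTerm x y (suc n) = begin
    C (suc n)
      ≡⟨ sym (trans (cong (_* C (suc n)) (trans (*-comm (+ 1 / suc n) _) (ι-*-1/ n))) (*-identityˡ _)) ⟩
    (+ 1 / suc n) * ι (suc n) * C (suc n)
      ≡⟨ *-assoc (+ 1 / suc n) (ι (suc n)) (C (suc n)) ⟩
    (+ 1 / suc n) * (ι (suc n) * C (suc n))
      ≡⟨ cong ((+ 1 / suc n) *_) (leibniz (suc n) (expTerm x) (expTerm y)) ⟩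
    (+ 1 / suc n) * (ι 0 * 1ℚ * expTerm y (suc n) + conv (weighted (expTerm x) ∘ suc) (expTerm y) n
                    + conv (expTerm x) (weighted (expTerm y)) (suc n))
      ≡⟨ cong ((+ 1 / suc n) *_) (cong₂ _+_
           (cong (_+_ (ι 0 * 1ℚ * expTerm y (suc n)))
             (trans (conv-cong n (weighted-expTerm x) (λ _ → refl)) (conv-*ˡ n x (expTerm x) (expTerm y))))
           (trans (conv-last n (expTerm x) (weighted (expTerm y)))
             (cong (_+ expTerm x (suc n) * (ι 0 * 1ℚ))
               (trans (conv-cong n (λ _ → refl) (weighted-expTerm y)) (conv-*ʳ n y (expTerm x) (expTerm y)))))) ⟩
    (+ 1 / suc n) * (ι 0 * 1ℚ * expTerm y (suc n) + x * C n + (y * C n + expTerm x (suc n) * (ι 0 * 1ℚ)))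
      ≡⟨ solve 6 (λ r x y c a b → r :* (con 0ℚ :* con 1ℚ :* a :+ x :* c :+ (y :* c :+ b :* (con 0ℚ :* con 1ℚ)))
                              := c :* ((x :+ y) :* r)) refl
           (+ 1 / suc n) x y (C n) (expTerm y (suc n)) (expTerm x (suc n)) ⟩
    C n * ((x + y) * (+ 1 / suc n))
      ≡⟨ cong (_* ((x + y) * (+ 1 / suc n))) (conv-expTerm x y n) ⟩
    expTerm (x + y) (suc n) ∎
    where
    open ≡-Reasoning
    C = conv (expTerm x) (expTerm y)

  -- The sum of f i · g j over i + j < N.
  triangle : (ℕ → ℚ) → (ℕ → ℚ) → ℕ → ℚ
  triangle f g N = Σ< N (conv f g)

  triangle-suc : ∀ N f g → triangle f g (suc N) ≡ f 0 * Σ< (suc N) g + triangle (f ∘ suc) g N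
  triangle-suc zero    f g = solve 2 (λ a b → con 0ℚ :+ a :* b := a :* (con 0ℚ :+ b) :+ con 0ℚ) refl (f 0) (g 0)
  triangle-suc (suc N) f g = trans (cong (_+ conv f g (suc N)) (triangle-suc N f g))
    (solve 5 (λ a s t b c → a :* s :+ t :+ (a :* b :+ c) := a :* (s :+ b) :+ (t :+ c)) refl
       (f 0) (Σ< (suc N) g) (triangle (f ∘ suc) g N) (g (suc N)) (conv (f ∘ suc) g N))

  conv-nonNeg : ∀ n {f g} → (∀ i → 0ℚ ≤ f i) → (∀ i → 0ℚ ≤ g i) → 0ℚ ≤ conv f g n
  conv-nonNeg zero    hf hg = *-nonNeg (hf 0) (hg 0)
  conv-nonNeg (suc n) hf hg = 0≤∑ (*-nonNeg (hf 0) (hg (suc n))) (conv-nonNeg n (hf ∘ suc) hg)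

  rectangle≤triangle : ∀ M N f g → (∀ i → 0ℚ ≤ f i) → (∀ i → 0ℚ ≤ g i) →
                       Σ< M f * Σ< N g ≤ triangle f g (M ℕ.+ N)
  rectangle≤triangle zero    N f g hf hg = cast (sym (*-zeroˡ (Σ< N g))) refl (Σ-nonNeg N (λ i → conv-nonNeg i hf hg))
  rectangle≤triangle (suc M) N f g hf hg = cast
    (sym (trans (cong (_* Σ< N g) (Σ-first M f)) (*-distribʳ-+ (Σ< N g) (f 0) (Σ< M (f ∘ suc)))))
    (sym (triangle-suc (M ℕ.+ N) f g))
    (*-monoˡ (hf 0) (Σ-grow hg (ℕ.m≤n+m N (suc M))) ⊕ rectangle≤triangle M N (f ∘ suc) g (hf ∘ suc) hg)

  -- The sum of f i · g j over the corner of the square i, j < N where i + j ≥ N.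
  excess : (ℕ → ℚ) → (ℕ → ℚ) → ℕ → ℚ
  excess f g N = Σ< N f * Σ< N g - triangle f g N

  -- The row i = 0 lies inside the triangle. After shifting the other rows, the corner consists of
  -- the smaller corner and the whole column j = N.
  excess-suc : ∀ N f g → excess f g (suc N) ≡ excess (f ∘ suc) g N + Σ< N (f ∘ suc) * g N
  excess-suc N f g = trans
    (cong₂ (λ a b → a * Σ< (suc N) g - b) (Σ-first N f) (triangle-suc N f g))
    (solve 5 (λ a s b c t → (a :+ s) :* (b :+ c) :- (a :* (b :+ c) :+ t) := s :* b :- t :+ s :* c) refl
       (f 0) (Σ< N (f ∘ suc)) (Σ< N g) (g N) (triangle (f ∘ suc) g N))

  ∣excess∣≤ : ∀ N f g → ∣ excess f g N ∣ ≤ excess (λ i → ∣ f i ∣) (λ i → ∣ g i ∣) N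
  ∣excess∣≤ zero    f g = ≤-refl
  ∣excess∣≤ (suc N) f g = cast (cong ∣_∣ (sym (excess-suc N f g))) (sym (excess-suc N (λ i → ∣ f i ∣) (λ i → ∣ g i ∣)))
    (≤-trans (∣p+q∣≤∣p∣+∣q∣ (excess (f ∘ suc) g N) (Σ< N (f ∘ suc) * g N))
      (∣excess∣≤ N (f ∘ suc) g ⊕ ≤-trans (≤-reflexive (∣p*q∣≡∣p∣*∣q∣ (Σ< N (f ∘ suc)) (g N)))
                                        (*-monoʳ (0≤∣p∣ (g N)) (∣Σ∣≤ N (f ∘ suc)))))

  excess-nonNeg : ∀ N f g → (∀ i → 0ℚ ≤ f i) → (∀ i → 0ℚ ≤ g i) → 0ℚ ≤ excess f g N
  excess-nonNeg zero    f g hf hg = ≤-refl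
  excess-nonNeg (suc N) f g hf hg = subst (0ℚ ≤_) (sym (excess-suc N f g))
    (0≤∑ (excess-nonNeg N (f ∘ suc) g (hf ∘ suc) hg) (*-nonNeg (Σ-nonNeg N (hf ∘ suc)) (hg N)))

  -- Partial sums of the exponential series

  expSum : ℚ → ℕ → ℚ
  expSum x N = Σ< N (expTerm x)

  triangle-expTerm : ∀ x y N → triangle (expTerm x) (expTerm y) N ≡ expSum (x + y) N
  triangle-expTerm x y N = Σ-cong N (conv-expTerm x y)

  expTerm-nonNeg : 0ℚ ≤ x → ∀ i → 0ℚ ≤ expTerm x i
  expTerm-nonNeg hx zero    = 0≤1
  expTerm-nonNeg hx (suc i) = *-nonNeg (expTerm-nonNeg hx i) (*-nonNeg hx (frac-nonNeg 1 i))

  expTerm-mono : 0ℚ ≤ x → x ≤ y → ∀ i → expTerm x i ≤ expTerm y i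
  expTerm-mono hx xy zero    = ≤-refl
  expTerm-mono hx xy (suc i) = *-mono (expTerm-nonNeg hx i) (*-nonNeg (≤-trans hx xy) (frac-nonNeg 1 i))
    (expTerm-mono hx xy i) (*-monoʳ (frac-nonNeg 1 i) xy)

  ∣expTerm∣ : ∀ x i → ∣ expTerm x i ∣ ≡ expTerm ∣ x ∣ i
  ∣expTerm∣ x zero    = refl
  ∣expTerm∣ x (suc i) = trans (∣p*q∣≡∣p∣*∣q∣ (expTerm x i) _)
    (cong₂ _*_ (∣expTerm∣ x i) (trans (∣p*q∣≡∣p∣*∣q∣ x _)
      (cong (∣ x ∣ *_) (0≤p⇒∣p∣≡p (frac-nonNeg 1 i)))))

  expSum-mono : 0ℚ ≤ x → x ≤ y → ∀ N → expSum x N ≤ expSum y N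
  expSum-mono hx xy N = Σ-mono N (λ i _ → expTerm-mono hx xy i)

  expSum-submult : ∀ N → 0ℚ ≤ x → 0ℚ ≤ y → expSum (x + y) N ≤ expSum x N * expSum y N
  expSum-submult {x} {y} N hx hy = cast
    (trans (+-identityʳ _) (triangle-expTerm x y N))
    (solve 2 (λ a b → b :+ (a :- b) := a) refl (expSum x N * expSum y N) (triangle (expTerm x) (expTerm y) N))
    (≤-refl {triangle (expTerm x) (expTerm y) N}
      ⊕ excess-nonNeg N (expTerm x) (expTerm y) (expTerm-nonNeg hx) (expTerm-nonNeg hy))

  -- 1 + a is the two-term partial sum of exp a, and a rectangle of indices with sides 2 and N fits
  -- into the triangle of size N + 2.
  1+a≤exp : ∀ N {a} → 0ℚ ≤ a → 0ℚ ≤ x → (1ℚ + a) * expSum x N ≤ expSum (x + a) (2 ℕ.+ N)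
  1+a≤exp {x} N {a} ha hx = cast
    (cong (_* expSum x N) (solve 1 (λ a → con 0ℚ :+ con 1ℚ :+ con 1ℚ :* (a :* con 1ℚ) := con 1ℚ :+ a) refl a))
    (trans (triangle-expTerm a x (2 ℕ.+ N)) (cong (λ z → expSum z (2 ℕ.+ N)) (+-comm a x)))
    (rectangle≤triangle 2 N (expTerm a) (expTerm x) (expTerm-nonNeg ha) (expTerm-nonNeg hx))

  expSum-1≤3 : ∀ N → expSum 1ℚ N ≤ ι 3
  expSum-1≤3 zero    = 0≤ι 3
  expSum-1≤3 (suc N) = ≤-trans (p≤p+q (*-nonNeg (0≤ι 2) (expTerm-nonNeg 0≤1 (suc N)))) (with-tail N)
    where
    -- Adding twice the next term makes the claim inductive: consecutive terms at least halve, so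
    -- the augmented sum never increases from its initial value 1 + 2.
    with-tail : ∀ N → expSum 1ℚ (suc N) + ι 2 * expTerm 1ℚ (suc N) ≤ ι 3
    with-tail zero    = ≤-refl
    with-tail (suc N) = ≤-trans (≤-refl {expSum 1ℚ (suc N)} ⊕ ≤-refl {t} ⊕ halve)
      (≤-trans (≤-reflexive (solve 2 (λ s t → s :+ t :+ t := s :+ con (ι 2) :* t) refl (expSum 1ℚ (suc N)) t))
               (with-tail N))
      where
      t = expTerm 1ℚ (suc N)
      halve : ι 2 * expTerm 1ℚ (suc (suc N)) ≤ t
      halve = cast (solve 2 (λ t r → t :* (con (ι 2) :* r) := con (ι 2) :* (t :* (con 1ℚ :* r))) refl t (+ 1 / suc (suc N)))
        (*-identityʳ t)
        (*-monoˡ (expTerm-nonNeg 0≤1 (suc N)) (≤-trans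
          (*-monoʳ (frac-nonNeg 1 (suc N)) (ι-mono (s≤s (s≤s (z≤n {N})))))
          (≤-reflexive (ι-*-1/ (suc N)))))

  exp0≡1 : ∀ N → expSum 0ℚ (suc N) ≡ 1ℚ
  exp0≡1 zero    = refl
  exp0≡1 (suc N) = trans (cong₂ _+_ (exp0≡1 N)
    (solve 2 (λ t r → t :* (con 0ℚ :* r) := con 0ℚ) refl (expTerm 0ℚ N) (+ 1 / suc N))) (+-identityʳ 1ℚ)

  expSum-ι≤3^ : ∀ m N → expSum (ι m) N ≤ ι (3 ℕ.^ m)
  expSum-ι≤3^ zero    zero    = 0≤1
  expSum-ι≤3^ zero    (suc N) = ≤-reflexive (exp0≡1 N)
  expSum-ι≤3^ (suc m) N = begin
    expSum (ι (suc m)) N         ≡⟨ cong (λ z → expSum z N) (ι-+ 1 m) ⟩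
    expSum (1ℚ + ι m) N          ≤⟨ expSum-submult N 0≤1 (0≤ι m) ⟩
    expSum 1ℚ N * expSum (ι m) N ≤⟨ *-mono (Σ-nonNeg N (expTerm-nonNeg 0≤1)) (0≤ι (3 ℕ.^ m))
                                      (expSum-1≤3 N) (expSum-ι≤3^ m N) ⟩
    ι 3 * ι (3 ℕ.^ m)            ≡⟨ sym (ι-* 3 (3 ℕ.^ m)) ⟩
    ι (3 ℕ.^ suc m)              ∎
    where open ≤-Reasoning

  -- The product of the partial sums of exp (- x) and exp x misses 1 by at most a
  -- tail of exp (2 x).
  expSum-inverse : ∀ x → 0ℚ ≤ x → ∀ N → 1ℚ ≤ expSum (- x) (suc N) * expSum x (suc N)
    + (expSum (x + x) (suc N ℕ.+ suc N) - expSum (x + x) (suc N))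
  expSum-inverse x hx N = begin
    1ℚ
      ≡⟨ solve 1 (λ p → con 1ℚ := p :+ :- (p :- con 1ℚ)) refl (s * expSum x (suc N)) ⟩
    s * expSum x (suc N) + - (s * expSum x (suc N) - 1ℚ)
      ≤⟨ ≤-refl {s * expSum x (suc N)} ⊕ -p≤∣p∣ (s * expSum x (suc N) - 1ℚ) ⟩
    s * expSum x (suc N) + ∣ s * expSum x (suc N) - 1ℚ ∣
      ≡⟨ cong (λ z → s * expSum x (suc N) + ∣ s * expSum x (suc N) - z ∣)
           (sym (trans (triangle-expTerm (- x) x (suc N))
             (trans (cong (λ z → expSum z (suc N)) (+-inverseˡ x)) (exp0≡1 N)))) ⟩
    s * expSum x (suc N) + ∣ excess (expTerm (- x)) (expTerm x) (suc N) ∣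
      -- The triangle part is the partial sum of exp 0, which is 1; only the corner is left. With
      -- absolute values it becomes the corner for exp x · exp x, where all terms are nonnegative.
      ≤⟨ ≤-refl {s * expSum x (suc N)} ⊕ ∣excess∣≤ (suc N) (expTerm (- x)) (expTerm x) ⟩
    s * expSum x (suc N) + excess (λ i → ∣ expTerm (- x) i ∣) (λ i → ∣ expTerm x i ∣) (suc N)
      ≡⟨ cong (_+_ (s * expSum x (suc N))) (cong₂ _-_
           (cong₂ _*_ (Σ-cong (suc N) abs₁) (Σ-cong (suc N) abs₂))
           (trans (Σ-cong (suc N) (λ i → conv-cong i abs₁ abs₂)) (triangle-expTerm x x (suc N)))) ⟩
    s * expSum x (suc N) + (expSum x (suc N) * expSum x (suc N) - expSum (x + x) (suc N))
      ≤⟨ ≤-refl {s * expSum x (suc N)} ⊕ (≤-trans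
           (rectangle≤triangle (suc N) (suc N) (expTerm x) (expTerm x) (expTerm-nonNeg hx) (expTerm-nonNeg hx))
           (≤-reflexive (triangle-expTerm x x (suc N ℕ.+ suc N))) ⊕ ≤-refl { - expSum (x + x) (suc N)}) ⟩
    s * expSum x (suc N) + (expSum (x + x) (suc N ℕ.+ suc N) - expSum (x + x) (suc N)) ∎
    where
    open ≤-Reasoning
    s = expSum (- x) (suc N)
    abs₂ : ∀ i → ∣ expTerm x i ∣ ≡ expTerm x i
    abs₂ i = 0≤p⇒∣p∣≡p (expTerm-nonNeg hx i)
    abs₁ : ∀ i → ∣ expTerm (- x) i ∣ ≡ expTerm x i
    abs₁ i = trans (∣expTerm∣ (- x) i) (cong (λ z → expTerm z i) (trans (∣-p∣≡∣p∣ x) (0≤p⇒∣p∣≡p hx)))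

  -- With E and s the partial sums of exp m and exp (-m), q E ≤ q 3^m ≤ 1 ≤ s E + tail. The tail is
  -- at most ε because exp (2m) is Cauchy, and E ≥ 1 bounds it by ε E, so that E can be cancelled.
  ≤exp-neg : ∀ m → q * ι (3 ℕ.^ m) ≤ 1ℚ → 0ℚ ≤ q → fromℚ q ≤ℝ exp (- ι m)
  ≤exp-neg {q} m hq 0≤q ε hε =
    let (N , close) = cauchy (exp (ι m + ι m)) ε hε in suc N , bound N close
    where
    bound : ∀ N → (∀ i j → N ℕ.≤ i → N ℕ.≤ j → ∣ expSum (ι m + ι m) i - expSum (ι m + ι m) j ∣ ≤ ε) →
            ∀ l → suc N ℕ.≤ l → q ≤ expSum (- ι m) l + ε
    bound N close (suc l) (s≤s N≤l) = *-cancelʳ-≤-pos E {{Data.Rational.positive E>0}} (begin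
      q * E                    ≤⟨ *-monoˡ 0≤q (expSum-ι≤3^ m (suc l)) ⟩
      q * ι (3 ℕ.^ m)          ≤⟨ hq ⟩
      1ℚ                       ≤⟨ expSum-inverse (ι m) (0≤ι m) l ⟩
      s * E + (expSum (ι m + ι m) (suc l ℕ.+ suc l) - expSum (ι m + ι m) (suc l))
                               ≤⟨ ≤-refl {s * E} ⊕ ≤-trans (p≤∣p∣ _) (close (suc l ℕ.+ suc l) (suc l)
                                    (ℕ.≤-trans N≤sl (ℕ.m≤m+n (suc l) (suc l))) N≤sl) ⟩
      s * E + ε                ≤⟨ ≤-refl {s * E} ⊕ ≤-trans (≤-reflexive (sym (*-identityʳ ε))) (*-monoˡ (<⇒≤ hε) 1≤E) ⟩
      s * E + ε * E            ≡⟨ sym (*-distribʳ-+ E s ε) ⟩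
      (s + ε) * E              ∎)
      where
      open ≤-Reasoning
      N≤sl = ℕ.m≤n⇒m≤1+n N≤l
      s = expSum (- ι m) (suc l)
      E = expSum (ι m) (suc l)
      1≤E : 1ℚ ≤ E
      1≤E = Σ-grow {1} {suc l} (expTerm-nonNeg (0≤ι m)) (s≤s z≤n)
      E>0 : 0ℚ < E
      E>0 = <-≤-trans (positive⁻¹ 1ℚ) 1≤E

module Constants where
  open import Data.Integer.Base using (+_)
  open import Data.Rational
    using (ℚ; _+_; _*_; _-_; -_; _≤_; _<_; _/_; ∣_∣; 0ℚ; 1ℚ; ½; _≤?_)
  open import Data.Rational.Properties hiding (_≤?_)
  open import Data.Rational.Solver using (module +-*-Solver)
  open +-*-Solver
  open Exponential

  -- Bounds for e, γ, log and π

  +-cancelʳ : ∀ r {p q} → p + r ≤ q + r → p ≤ q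
  +-cancelʳ r {p} {q} h = cast (lem p) (lem q) (h ⊕ ≤-refl { - r})
    where
    lem : ∀ p → p + r + - r ≡ p
    lem p = solve 2 (λ p r → p :+ r :+ :- r := p) refl p r

  8/3≤e : ∀ N → 4 ℕ.≤ N → + 8 / 3 ≤ seq e N
  8/3≤e N h = ≤-trans (≤-reflexive refl) (Σ-grow {4} {N} {expTerm 1ℚ} (expTerm-nonNeg 0≤1) h)

  -- `seq γ N` is the harmonic number minus a Riemann sum of mesh 1/(s + 1), with s fixed by
  -- `diagonal`. Since s is not a usable numeral, the mesh is exchanged for a free parameter `t`,
  -- chosen as a numeral for computation or as N to match the approximation of log.
  harmonic≤γ : ∀ p t N → p ℕ.≤ N →
               harmonic (suc p) ≤ seq γ N + + 1 / suc p + (riemann recip 1ℚ p t + + 1 / suc t)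
  harmonic≤γ p t N p≤N = begin
    harmonic (suc p)
      ≡⟨ solve 2 (λ h r → h := h :- r :+ r) refl (harmonic (suc p)) R ⟩
    harmonic (suc p) - R + R
      ≤⟨ subst (λ l → seq (γ-approx p) s ≤ seq (γ-approx l) s + + 1 / suc p) (ℕ.m∸n+n≡m p≤N) (γ-up′ (N ℕ.∸ p) p s)
         ⊕ ≤-trans (riemann-close recip 1ℚ p recip-antitone s t)
                   (≤-reflexive (cong (_+_ (riemann recip 1ℚ p t)) (*-identityˡ _))) ⟩
    seq γ N + + 1 / suc p + (riemann recip 1ℚ p t + + 1 / suc t) ∎
    where
    open ≤-Reasoning
    s = diagonal γ-approx N
    R = riemann recip 1ℚ p s

  -- The value 3/8 is the reciprocal of the lower bound 8/3 for e, so that e γ ≥ 1. The bound at H₄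
  -- with mesh 1/10 suffices and is checked by evaluation.
  3/8≤γ : ∀ N → 3 ℕ.≤ N → + 3 / 8 ≤ seq γ N
  3/8≤γ N h = +-cancelʳ c (≤-trans numeric
      (≤-trans (harmonic≤γ 3 9 N h) (≤-reflexive (+-assoc (seq γ N) _ _))))
    where
    c = + 1 / 4 + (riemann recip 1ℚ 3 9 + + 1 / 10)
    numeric : + 3 / 8 + c ≤ harmonic 4
    numeric = toWitness {a? = (+ 3 / 8 + c) ≤? harmonic 4} tt

  -- For p > 0 the bound γ ≥ H_{p+1} - log (p + 1) - 1/(p + 1) suffices; for p = 0 the
  -- left side is 1, and γ ≥ 3/8 comes from the same bound at 4.
  harmonic≤log : ∀ p N → 5 ℕ.+ p ℕ.≤ N →
    ι 2 * (harmonic (2 ℕ.+ p) - 1ℚ) ≤ seq e N * (riemann recip 1ℚ p N + seq γ N)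
  harmonic≤log zero N h = ≤-trans
    (≤-reflexive refl)
    (*-mono {+ 8 / 3} {seq e N} {+ 3 / 8} (frac-nonNeg 8 2)
      (≤-trans (frac-nonNeg 3 7) 3/8≤)
      (8/3≤e N (ℕ.≤-trans (ℕ.n≤1+n 4) h)) 3/8≤)
    where
    3/8≤ : + 3 / 8 ≤ 0ℚ + seq γ N
    3/8≤ = ≤-trans (3/8≤γ N (ℕ.≤-trans (ℕ.m≤m+n 3 2) h)) (≤-reflexive (sym (+-identityˡ (seq γ N))))
  harmonic≤log (suc p) N h = *-mono (0≤ι 2) (≤-trans H≥0 bound)
    (≤-trans (toWitness {a? = ι 2 ≤? (+ 8 / 3)} tt) (8/3≤e N (ℕ.≤-trans (ℕ.m≤m+n 4 (2 ℕ.+ p)) (ℕ.≤-trans (ℕ.≤-reflexive (lem p)) h))))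
    bound
    where
    lem : ∀ p → 4 ℕ.+ (2 ℕ.+ p) ≡ 5 ℕ.+ suc p
    lem = solve-∀
    L = riemann recip 1ℚ (suc p) N + seq γ N
    H≥0 : 0ℚ ≤ harmonic (3 ℕ.+ p) - 1ℚ
    H≥0 = cast (+-inverseʳ 1ℚ) refl
      (Σ-grow {1} {3 ℕ.+ p} {λ i → + 1 / suc i} (λ i → frac-nonNeg 1 i) (s≤s z≤n) ⊕ ≤-refl { - 1ℚ})
    bound : harmonic (3 ℕ.+ p) - 1ℚ ≤ L
    bound = begin
      harmonic (2 ℕ.+ p) + + 1 / (3 ℕ.+ p) - 1ℚ
        ≤⟨ harmonic≤γ (suc p) N N (ℕ.≤-trans (ℕ.m≤n+m (suc p) 5) h)
           ⊕ frac-≤ {1} {2 ℕ.+ p} {1} {2} (ℕ.*-monoʳ-≤ 1 (ℕ.m≤m+n 3 p)) ⊕ ≤-refl { - 1ℚ} ⟩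
      seq γ N + + 1 / (2 ℕ.+ p) + (R + + 1 / suc N) + + 1 / 3 - 1ℚ
        ≤⟨ ≤-refl {seq γ N} ⊕ frac-≤ {1} {1 ℕ.+ p} {1} {1} (ℕ.*-monoʳ-≤ 1 (ℕ.m≤m+n 2 p))
           ⊕ (≤-refl {R} ⊕ frac-≤ {1} {N} {1} {5} (ℕ.*-monoʳ-≤ 1 (s≤s (ℕ.≤-trans (ℕ.m≤m+n 5 (suc p)) h))))
           ⊕ ≤-refl {+ 1 / 3} ⊕ ≤-refl { - 1ℚ} ⟩
      seq γ N + + 1 / 2 + (R + + 1 / 6) + + 1 / 3 - 1ℚ
        ≡⟨ solve 2 (λ g r → g :+ con (+ 1 / 2) :+ (r :+ con (+ 1 / 6)) :+ con (+ 1 / 3) :- con 1ℚ := r :+ g) refl (seq γ N) R ⟩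
      L ∎
      where
      open ≤-Reasoning
      R = riemann recip 1ℚ (suc p) N

  -- The right sum with mesh 1/2 is 13/20, and N ≥ 39 makes the mesh error at most 1/40; four times
  -- the difference 5/8 is 5/2.
  5/2≤π : ∀ N → 39 ℕ.≤ N → + 5 / 2 ≤ seq π N
  5/2≤π N h = ≤-trans (≤-reflexive refl) (*-monoˡ {ι 4} {+ 5 / 8} {riemann cauchyDensity 0ℚ 1 N} (0≤ι 4)
    (+-cancelʳ (+ 1 / 40) (≤-trans
      (riemann-close cauchyDensity 0ℚ 1 cauchyDensity-antitone 1 N)
      (≤-refl {riemann cauchyDensity 0ℚ 1 N} ⊕ ≤-trans (≤-reflexive (*-identityˡ (+ 1 / suc N)))
        (frac-≤ {1} {N} {1} {39} (ℕ.*-monoʳ-≤ 1 (s≤s h)))))))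

  2≤eπ²/6 : ∀ N → 39 ℕ.≤ N → ι 2 ≤ seq e N * (seq π N * seq π N) * (+ 1 / 6)
  2≤eπ²/6 N h = ≤-trans (toWitness {a? = ι 2 ≤? (+ 8 / 3) * (+ 5 / 2 * (+ 5 / 2)) * (+ 1 / 6)} tt)
    (*-monoʳ (frac-nonNeg 1 5) (*-mono (frac-nonNeg 8 2) (*-nonNeg π≥0 π≥0)
      (8/3≤e N (ℕ.≤-trans (ℕ.m≤m+n 4 35) h))
      (*-mono (frac-nonNeg 5 1) π≥0 (5/2≤π N h) (5/2≤π N h))))
    where
    π≥0 : 0ℚ ≤ seq π N
    π≥0 = ≤-trans (frac-nonNeg 5 1) (5/2≤π N h)

  -- Telescoping with 1/m² ≤ 1/(m - 1) - 1/m for m ≥ 2; the remaining 1/(n + 1) is kept for the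
  -- induction.
  square≤telescope : ∀ n → Σ< n (λ i → (+ 1 / suc (suc i)) * (+ 1 / suc (suc i))) + + 1 / suc n ≤ 1ℚ
  square≤telescope zero    = ≤-refl
  square≤telescope (suc n) = ≤-trans (≤-trans (≤-reflexive (+-assoc S _ _)) (≤-refl {S} ⊕ step)) (square≤telescope n)
    where
    S = Σ< n (λ i → (+ 1 / suc (suc i)) * (+ 1 / suc (suc i)))
    d = suc n ℕ.+ suc n ℕ.* suc (suc n)
    lem : ∀ n → (1 ℕ.* 1 ℕ.+ (2 ℕ.+ n)) ℕ.* (1 ℕ.+ n) ℕ.+ 1 ≡ 1 ℕ.* ((2 ℕ.+ n) ℕ.* (2 ℕ.+ n))
    lem = solve-∀
    step : (+ 1 / suc (suc n)) * (+ 1 / suc (suc n)) + + 1 / suc (suc n) ≤ + 1 / suc n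
    step = ≤-trans (≤-reflexive (trans
        (cong₂ _+_ (frac-* 1 1 (suc n) (suc n))
          (frac-≡ {1} {suc n} {suc (suc n)} {d} (ℕ.*-identityˡ _)))
        (frac-+ 1 (suc (suc n)) d)))
      (frac-≤ {1 ℕ.* 1 ℕ.+ suc (suc n)} {d} {1} {n}
        (ℕ.≤-trans (ℕ.m≤m+n _ 1) (ℕ.≤-reflexive (lem n))))

  -- Twice the expected weight against the threshold

  -- With K = k c₁, a bound for twice the probability that the position i + 2
  -- (counted from 1) lies in the optimization set.
  excessRate : ℕ → ℕ → ℕ → ℚ
  excessRate K B i = ι 2 * (ι K * (+ 1 / suc (suc i)) + ι B * ((+ 1 / suc (suc i)) * (+ 1 / suc (suc i))))

  excessRate-nonNeg : ∀ K B i → 0ℚ ≤ excessRate K B i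
  excessRate-nonNeg K B i = *-nonNeg (0≤ι 2) (0≤∑ (*-nonNeg (0≤ι K) (frac-nonNeg 1 (suc i)))
    (*-nonNeg (0≤ι B) (*-nonNeg (frac-nonNeg 1 (suc i)) (frac-nonNeg 1 (suc i)))))

  Σ-excessRate : ∀ K B n → Σ< n (excessRate K B) ≤ ι K * (ι 2 * (harmonic (suc n) - 1ℚ)) + ι 2 * ι B
  Σ-excessRate K B n = begin
    Σ< n (excessRate K B)
      ≡⟨ trans (Σ-* n (ι 2) _) (cong (ι 2 *_) (trans (Σ-+ n _ _) (cong₂ _+_ (Σ-* n (ι K) _) (Σ-* n (ι B) _)))) ⟩
    ι 2 * (ι K * H + ι B * S)
      ≤⟨ *-monoˡ (0≤ι 2) (≤-refl {ι K * H} ⊕ *-monoˡ (0≤ι B)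
           (≤-trans (p≤p+q (frac-nonNeg 1 n)) (square≤telescope n))) ⟩
    ι 2 * (ι K * H + ι B * 1ℚ)
      ≡⟨ solve 3 (λ k h b → con (ι 2) :* (k :* h :+ b :* con 1ℚ) := k :* (con (ι 2) :* (con 1ℚ :+ h :- con 1ℚ)) :+ con (ι 2) :* b)
           refl (ι K) H (ι B) ⟩
    ι K * (ι 2 * (1ℚ + H - 1ℚ)) + ι 2 * ι B
      ≡⟨ cong (λ h → ι K * (ι 2 * (h - 1ℚ)) + ι 2 * ι B) (sym (Σ-first n (λ i → + 1 / suc i))) ⟩
    ι K * (ι 2 * (harmonic (suc n) - 1ℚ)) + ι 2 * ι B ∎
    where
    open ≤-Reasoning
    H = Σ< n (λ i → + 1 / suc (suc i))
    S = Σ< n (λ i → (+ 1 / suc (suc i)) * (+ 1 / suc (suc i)))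

  ≤-by-ε : ∀ {p q} → (∀ ε → 0ℚ < ε → p ≤ q + ε) → p ≤ q
  ≤-by-ε {p} {q} h = ≮⇒≥ λ q<p →
    let gap = subst (_< p - q) (+-inverseʳ q) (+-monoˡ-< (- q) q<p) in
    <-irrefl refl (<-≤-trans (half-pos gap) (+-cancelʳ (half (p - q)) (cast
        (solve 2 (λ p q → p :- q := con ½ :* (p :- q) :+ con ½ :* (p :- q)) refl p q)
        (solve 2 (λ q h → q :+ h :- q := con 0ℚ :+ h) refl q (half (p - q)))
        (h (half (p - q)) (half-pos gap) ⊕ ≤-refl { - q}))))

  threshold-bound : ∀ p k (c : Vec (Fin 2) (suc (suc k))) (2≤n : 2 ℕ.≤ 2 ℕ.+ p) (1≤k : 1 ℕ.≤ suc k) z →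
    threshold (2 ℕ.+ p) 2≤n 1≤k c ≤ℝ fromℤ z →
    Σ< (suc p) (excessRate (suc k ℕ.* toℕ (lookup c (suc zero))) (binomialSum c)) ≤ z / 1
  threshold-bound p k c 2≤n (s≤s z≤n) z h = ≤-by-ε λ ε hε →
    let (N , bound) = h ε hε
        -- From this index on, the hypothesis up to ε and the bounds for e, γ, log and π hold
        -- together; 39 is the index required for π.
        M = N ℕ.⊔ (39 ℕ.+ p)
    in ≤-trans (≤-trans (Σ-excessRate K B (suc p)) (eventually M (ℕ.m≤n⊔m N (39 ℕ.+ p)))) (bound M (ℕ.m≤m⊔n N (39 ℕ.+ p)))
    where
    c₁ = toℕ (lookup c (suc zero))
    K = suc k ℕ.* c₁
    B = binomialSum c
    eventually : ∀ N → 39 ℕ.+ p ℕ.≤ N →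
      ι K * (ι 2 * (harmonic (2 ℕ.+ p) - 1ℚ)) + ι 2 * ι B ≤ seq (threshold (2 ℕ.+ p) 2≤n (s≤s z≤n) c) N
    eventually N hN = ≤-trans
      (*-monoˡ (0≤ι K) (harmonic≤log p N (ℕ.≤-trans (ℕ.+-monoˡ-≤ p (ℕ.m≤m+n 5 34)) hN))
        ⊕ *-monoʳ (0≤ι B) (2≤eπ²/6 N (ℕ.≤-trans (ℕ.m≤m+n 39 p) hN)))
      (≤-reflexive (cong (_+ seq e N * (seq π N * seq π N) * (+ 1 / 6) * ι B)
        (trans (cong (_* (seq e N * (riemann recip 1ℚ p N + seq γ N))) (ι-* (suc k) c₁))
          (solve 4 (λ k c e l → k :* c :* (e :* l) := e :* k :* c :* l) refl
             (ι (suc k)) (ι c₁) (seq e N) (riemann recip 1ℚ p N + seq γ N)))))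

module Tail where
  open import Data.Integer.Base using (+_; -[1+_])
  open import Data.Rational
    using (ℚ; _+_; _*_; _-_; -_; _≤_; _<_; _/_; 0ℚ; 1ℚ; positive)
  open import Data.Rational.Properties
  open import Data.Rational.Solver using (module +-*-Solver)
  open +-*-Solver
  open Exponential
  open Constants
  open Counting
    using (∏; ∏-last; ∑; Σℕ; steps; at; at-toℕ; selection-bound; restWeight; ∑-restWeight;
           factorial-^; markov)

  -- Tail probabilities

  cancel-pos : ∀ {p q} r → 0ℚ < r → p * r ≤ q * r → p ≤ q
  cancel-pos r hr = *-cancelʳ-≤-pos r {{positive hr}}

  0<ι : ∀ n .{{_ : ℕ.NonZero n}} → 0ℚ < ι n
  0<ι (suc n) = <-≤-trans (positive⁻¹ 1ℚ) (ι-mono (s≤s (z≤n {n})))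

  -- Each factor 1 + a lengthens the partial sum by two terms through `1+a≤exp`; the empty product
  -- starts with the one-term sum, hence the length 2 n + 1.
  ∏≤exp : ∀ n (f g : Fin n → ℕ) (a : ℕ → ℚ) → (∀ i → 0ℚ ≤ a i) →
          (∀ i → ι (f i) ≤ ι (g i) * (1ℚ + a (toℕ i))) →
          ι (∏ n f) ≤ ι (∏ n g) * expSum (Σ< n a) (suc (n ℕ.* 2))
  ∏≤exp zero    f g a ha h = ≤-refl
  ∏≤exp (suc n) f g a ha h = begin
    ι (∏ (suc n) f)
      ≡⟨ trans (cong ι (∏-last n f)) (ι-* (∏ n (f ∘ inject₁)) (f (fromℕ n))) ⟩
    ι (∏ n (f ∘ inject₁)) * ι (f (fromℕ n))
      ≤⟨ *-mono (0≤ι (∏ n (f ∘ inject₁))) (*-nonNeg (0≤ι (g (fromℕ n))) (0≤∑ 0≤1 (ha n)))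
           (∏≤exp n (f ∘ inject₁) (g ∘ inject₁) a ha λ i →
             subst (λ l → ι (f (inject₁ i)) ≤ ι (g (inject₁ i)) * (1ℚ + a l)) (Fin.toℕ-inject₁ i) (h (inject₁ i)))
           (subst (λ l → ι (f (fromℕ n)) ≤ ι (g (fromℕ n)) * (1ℚ + a l)) (Fin.toℕ-fromℕ n) (h (fromℕ n))) ⟩
    G * E * (γₙ * (1ℚ + a n))
      ≡⟨ solve 4 (λ g e c a → g :* e :* (c :* a) := g :* c :* (a :* e)) refl G E γₙ (1ℚ + a n) ⟩
    G * γₙ * ((1ℚ + a n) * E)
      ≤⟨ *-monoˡ (*-nonNeg (0≤ι (∏ n (g ∘ inject₁))) (0≤ι (g (fromℕ n)))) (1+a≤exp (suc (n ℕ.* 2)) (ha n) (Σ-nonNeg n ha)) ⟩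
    G * γₙ * expSum (Σ< (suc n) a) (suc (suc n ℕ.* 2))
      ≡⟨ cong (_* expSum (Σ< (suc n) a) (suc (suc n ℕ.* 2)))
           (trans (sym (ι-* (∏ n (g ∘ inject₁)) (g (fromℕ n)))) (cong ι (sym (∏-last n g)))) ⟩
    ι (∏ (suc n) g) * expSum (Σ< (suc n) a) (suc (suc n ℕ.* 2)) ∎
    where
    open ≤-Reasoning
    G = ι (∏ n (g ∘ inject₁))
    γₙ = ι (g (fromℕ n))
    E = expSum (Σ< n a) (suc (n ℕ.* 2))

  factor-bound : ∀ k (c : Vec (Fin 2) (suc (suc k))) → lookup c zero ≡ zero → ∀ i →
    ι (suc (suc i) ℕ.^ suc k ℕ.+ 2 ℕ.* steps (suc k) (suc i) (at c) 0) ≤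
    ι (suc (suc i) ℕ.^ suc k) * (1ℚ + excessRate (suc k ℕ.* toℕ (lookup c (suc zero))) (binomialSum c) i)
  factor-bound k c c₀ i = begin
    ι (α ℕ.^ suc k ℕ.+ 2 ℕ.* q)
      ≡⟨ trans (ι-+ (α ℕ.^ suc k) (2 ℕ.* q)) (cong (_+_ A) (ι-* 2 q)) ⟩
    A + ι 2 * ι q
      -- Inserting (α · 1/α)² = 1 produces the α² q that `selection-bound` estimates.
      ≡⟨ cong (λ x → A + ι 2 * x) (trans (sym (*-identityˡ (ι q)))
           (trans (cong (_* ι q) (sym (cong₂ _*_ (ι-*-1/ (suc i)) (ι-*-1/ (suc i)))))
             (solve 3 (λ a r q → a :* r :* (a :* r) :* q := a :* a :* q :* (r :* r)) refl (ι α) r (ι q)))) ⟩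
    A + ι 2 * (ι α * ι α * ι q * (r * r))
      ≤⟨ ≤-refl {A} ⊕ *-monoˡ (0≤ι 2) (*-monoʳ (*-nonNeg r≥0 r≥0)
           (cast (trans (ι-* (α ℕ.^ 2) q) (cong (_* ι q) (trans (cong ι (cong (α ℕ.*_) (ℕ.*-identityʳ α))) (ι-* α α))))
                 (trans (ι-* (α ℕ.^ suc k) (K′ ℕ.* α ℕ.+ B)) (cong (A *_)
                   (trans (ι-+ (K′ ℕ.* α) B) (cong (_+ ι B) (trans (ι-* K′ α)
                     (cong (λ x → ι (suc k ℕ.* x) * ι α) (at-toℕ c (suc zero))))))))
                 (ι-mono (selection-bound k (suc i) c c₀)))) ⟩
    A + ι 2 * (A * (ι K * ι α + ι B) * (r * r))
      ≡⟨ solve 5 (λ A K B a r → A :+ con (ι 2) :* (A :* (K :* a :+ B) :* (r :* r))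
                             := A :* (con 1ℚ :+ con (ι 2) :* (K :* (r :* (a :* r)) :+ B :* (r :* r)))) refl A (ι K) (ι B) (ι α) r ⟩
    A * (1ℚ + ι 2 * (ι K * (r * (ι α * r)) + ι B * (r * r)))
      ≡⟨ cong (λ x → A * (1ℚ + ι 2 * (ι K * x + ι B * (r * r))))
           (trans (cong (r *_) (ι-*-1/ (suc i))) (*-identityʳ r)) ⟩
    A * (1ℚ + excessRate K B i) ∎
    where
    open ≤-Reasoning
    α = suc (suc i)
    A = ι (α ℕ.^ suc k)
    q = steps (suc k) (suc i) (at c) 0
    r = + 1 / α
    r≥0 = frac-nonNeg 1 (suc i)
    B = binomialSum c
    K = suc k ℕ.* toℕ (lookup c (suc zero))
    K′ = suc k ℕ.* at c 1

  generating-bound : ∀ p k (c : Vec (Fin 2) (suc (suc k))) → lookup c zero ≡ zero → ∀ z →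
    Σ< p (excessRate (suc k ℕ.* toℕ (lookup c (suc zero))) (binomialSum c)) ≤ ι z →
    ∑ (permutationTuples (suc k) (suc p)) (λ σs → 3 ℕ.^ restWeight c σs) ℕ.≤ (suc p !) ℕ.^ suc k ℕ.* 3 ℕ.^ z
  generating-bound p k c c₀ z h = ι-cancel (begin
    ι (∑ (permutationTuples (suc k) (suc p)) (λ σs → 3 ℕ.^ restWeight c σs))
      ≡⟨ cong ι (∑-restWeight (suc k) p c) ⟩
    ι (∏ p (λ α → suc (suc (toℕ α)) ℕ.^ suc k ℕ.+ 2 ℕ.* steps (suc k) (suc (toℕ α)) (at c) 0))
      ≤⟨ ∏≤exp p _ _ (excessRate K B) (excessRate-nonNeg K B) (λ α → factor-bound k c c₀ (toℕ α)) ⟩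
    ι (∏ p (λ α → suc (suc (toℕ α)) ℕ.^ suc k)) * expSum (Σ< p (excessRate K B)) (suc (p ℕ.* 2))
      ≤⟨ *-monoˡ (0≤ι (∏ p (λ α → suc (suc (toℕ α)) ℕ.^ suc k))) (≤-trans (expSum-mono (Σ-nonNeg p (excessRate-nonNeg K B)) h (suc (p ℕ.* 2)))
           (expSum-ι≤3^ z (suc (p ℕ.* 2)))) ⟩
    ι (∏ p (λ α → suc (suc (toℕ α)) ℕ.^ suc k)) * ι (3 ℕ.^ z)
      ≡⟨ cong (λ d → ι d * ι (3 ℕ.^ z)) (sym (factorial-^ p (suc k))) ⟩
    ι ((suc p !) ℕ.^ suc k) * ι (3 ℕ.^ z)
      ≡⟨ sym (ι-* ((suc p !) ℕ.^ suc k) (3 ℕ.^ z)) ⟩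
    ι ((suc p !) ℕ.^ suc k ℕ.* 3 ℕ.^ z) ∎)
    where
    open ≤-Reasoning
    B = binomialSum c
    K = suc k ℕ.* toℕ (lookup c (suc zero))
    ι-cancel : ∀ {m n} → ι m ≤ ι n → m ℕ.≤ n
    ι-cancel {m} {n} h = ℕ.≮⇒≥ λ n<m → <-irrefl refl (<-≤-trans
      (cast-< (ι-+ 1 n) (+-monoˡ-< (ι n) (positive⁻¹ 1ℚ))) (≤-trans (ι-mono n<m) h))
      where
      cast-< : ∀ {x} → x ≡ 1ℚ + ι n → 0ℚ + ι n < 1ℚ + ι n → ι n < x
      cast-< refl lt = subst (_< 1ℚ + ι n) (+-identityˡ (ι n)) lt

  P-sum : ∀ {k} (c : Vec (Fin 2) (suc k)) n len (v : ℕ → ℤ) →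
          Σ< len (λ i → P c n (v i)) * ι ((n !) ℕ.^ k) ≡ ι (Σℕ len (λ i → O c n (v i)))
  P-sum {k} c n len v = go len
    where
    D = (n !) ℕ.^ k
    /-* : ∀ a d .{{_ : ℕ.NonZero d}} → (+ a / d) * ι d ≡ ι a
    /-* a (suc d) = trans (frac-* a (suc d) d 0)
      (frac-≡ {a ℕ.* suc d} {d ℕ.* 1} {a} {0} (trans (ℕ.*-identityʳ _) (cong (λ x → a ℕ.* suc x) (sym (ℕ.*-identityʳ d)))))
    go : ∀ len → Σ< len (λ i → P c n (v i)) * ι D ≡ ι (Σℕ len (λ i → O c n (v i)))
    go zero      = *-zeroˡ (ι D)
    go (suc len) = trans (*-distribʳ-+ (ι D) (Σ< len (λ i → P c n (v i))) (P c n (v len)))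
      (trans (cong₂ _+_ (go len) (/-* (O c n (v len)) D {{ℕ.m^n≢0 (n !) k {{n ℕ.!≢0}}}}))
             (sym (ι-+ (Σℕ len (λ i → O c n (v i))) (O c n (v len)))))

  0≤P : ∀ {k} (c : Vec (Fin 2) (suc k)) n m → 0ℚ ≤ P c n m
  0≤P {k} c n m = go ((n !) ℕ.^ k) {{ℕ.m^n≢0 (n !) k {{n ℕ.!≢0}}}}
    where
    go : ∀ d .{{_ : ℕ.NonZero d}} → 0ℚ ≤ + O c n m / d
    go (suc d) = frac-nonNeg (O c n m) d

  ratio≤3^- : ∀ q N D .{{_ : ℕ.NonZero D}} z m → q * ι D ≡ ι N →
              N ℕ.* 3 ℕ.^ (z ℕ.+ m) ℕ.≤ D ℕ.* 3 ℕ.^ z → q * ι (3 ℕ.^ m) ≤ 1ℚ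
  ratio≤3^- q N D z m qD h = cancel-pos (ι (D ℕ.* 3 ℕ.^ z)) (0<ι (D ℕ.* 3 ℕ.^ z)) (begin
    q * ι (3 ℕ.^ m) * ι (D ℕ.* 3 ℕ.^ z)
      ≡⟨ cong (q * ι (3 ℕ.^ m) *_) (ι-* D (3 ℕ.^ z)) ⟩
    q * ι (3 ℕ.^ m) * (ι D * ι (3 ℕ.^ z))
      ≡⟨ solve 4 (λ q m d z → q :* m :* (d :* z) := q :* d :* (z :* m)) refl q (ι (3 ℕ.^ m)) (ι D) (ι (3 ℕ.^ z)) ⟩
    q * ι D * (ι (3 ℕ.^ z) * ι (3 ℕ.^ m))
      ≡⟨ cong₂ _*_ qD
           (trans (sym (ι-* (3 ℕ.^ z) (3 ℕ.^ m))) (cong ι (sym (ℕ.^-distribˡ-+-* 3 z m)))) ⟩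
    ι N * ι (3 ℕ.^ (z ℕ.+ m))
      ≡⟨ sym (ι-* N (3 ℕ.^ (z ℕ.+ m))) ⟩
    ι (N ℕ.* 3 ℕ.^ (z ℕ.+ m))
      ≤⟨ ι-mono h ⟩
    ι (D ℕ.* 3 ℕ.^ z)
      ≡⟨ sym (*-identityˡ (ι (D ℕ.* 3 ℕ.^ z))) ⟩
    1ℚ * ι (D ℕ.* 3 ℕ.^ z) ∎)
    where
    open ≤-Reasoning
    instance
      _ = ℕ.m*n≢0 D (3 ℕ.^ z) {{it}} {{ℕ.m^n≢0 3 z}}

  -- c′ is c in part (i) and its complement in part (ii).
  tail-bound : ∀ p k (c c′ : Vec (Fin 2) (suc (suc k))) → lookup c′ zero ≡ zero → ∀ z M₁ len (v : ℕ → ℤ) b →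
    Σ< p (excessRate (suc k ℕ.* toℕ (lookup c′ (suc zero))) (binomialSum c′)) ≤ ι z →
    (∀ i → v i ≡ + (b ℕ.+ i)) →
    (∀ σs i → i ℕ.< len → weight c σs ≡ b ℕ.+ i → z ℕ.+ M₁ ℕ.≤ restWeight c′ σs) →
    fromℚ (Σ< len (λ i → P c (suc p) (v i))) ≤ℝ exp (- ι M₁)
  tail-bound p k c c′ c₀ z M₁ len v b h hv hY = ≤exp-neg M₁
    (ratio≤3^- Q (Σℕ len (λ i → O c (suc p) (v i))) ((suc p !) ℕ.^ suc k) {{D≢0}} z M₁
      (P-sum c (suc p) len v)
      (ℕ.≤-trans (markov c (restWeight {n = p} c′) (z ℕ.+ M₁) len v b hv hY) (generating-bound p k c′ c₀ z h)))
    (Σ-nonNeg len (λ i → 0≤P c (suc p) (v i)))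
    where
    Q = Σ< len (λ i → P c (suc p) (v i))
    D≢0 : ℕ.NonZero ((suc p !) ℕ.^ suc k)
    D≢0 = ℕ.m^n≢0 (suc p !) (suc k) {{suc p ℕ.!≢0}}

  -- The ceiling is given as an integer, but it serves as the exponent of a power of 3 and must be
  -- natural.
  ceiling-nonNeg : ∀ z → 0ℚ ≤ z / 1 → ∃ λ z′ → z ≡ + z′
  ceiling-nonNeg (+ z)    h = z , refl
  ceiling-nonNeg -[1+ m ] h = contradiction
    (<-≤-trans (0<ι (suc m)) (cast (solve 1 (λ x → con 0ℚ :+ x := x) refl (ι (suc m)))
      (+-inverseˡ (ι (suc m))) (h ⊕ ≤-refl {ι (suc m)}))) (<-irrefl refl)

  <∣⊔0∣ : ∀ {i} x → i ℕ.< ℤ.∣ x ℤ.⊔ + 0 ∣ → + suc i ℤ.≤ x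
  <∣⊔0∣ (+ a)    h = ℤ.+≤+ (ℕ.≤-trans h (ℕ.≤-reflexive (ℕ.⊔-identityʳ a)))
  <∣⊔0∣ -[1+ a ] ()

-- The upper tail and, by complement, the lower tail

open import Data.Integer.Base using (+_)
open import Data.Rational.Base using (ℚ; 0ℚ; _≤_; _/_)
open Exponential
open Constants
open Counting using (weight≡; restWeight; restWeight-complement)
open Tail

theorem5p2 : (n k M₁ : ℕ) (2≤n : 2 ℕ.≤ n) (1≤k : 1 ℕ.≤ k) → 1 ℕ.≤ M₁ →
    (c : Vec (Fin 2) (suc k)) →
    let P′ = λ m → P c n (m ℤ.+ + toℕ (lookup c (fromℕ k)) ℤ.- + 1) in
    ( lookup c zero ≡ zero →
    ∀ z → IsCeiling (threshold n 2≤n 1≤k c) z →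
    let M = z ℤ.+ + M₁ in
    fromℚ (Σℤ (M ℤ.+ + 1) (+ n ℤ.+ + 1) P′) ≤ℝ exp ((ℤ.- + M₁) / 1) )
    ×
    ( lookup c zero ≡ suc zero →
    ∀ z → IsCeiling (threshold n 2≤n 1≤k (complement c)) z →
    let M′ = z ℤ.+ + M₁ in
    fromℚ (Σℤ (+ 1) (+ n ℤ.+ + 1 ℤ.- M′) P′) ≤ℝ exp ((ℤ.- + M₁) / 1) )
theorem5p2 (suc zero) _ _ (s≤s ())
-- Matching M₁ as a successor lets the exponent `(ℤ.- + M₁) / 1` reduce to `- ι M₁`.
theorem5p2 (suc (suc p)) (suc k) (suc m₁) 2≤n 1≤k _ c = upper , lower
  where
  M₁ = suc m₁
  n = suc (suc p)
  cₖ = toℕ (lookup c (fromℕ (suc k)))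
  P′ : ℤ → ℚ
  P′ m = P c n (m ℤ.+ + cₖ ℤ.- + 1)

  rate : Vec (Fin 2) (suc (suc k)) → ℚ
  rate c = Σ< (suc p) (excessRate (suc k ℕ.* toℕ (lookup c (suc zero))) (binomialSum c))

  rate-nonNeg : ∀ c → 0ℚ ≤ rate c
  rate-nonNeg c = Σ-nonNeg (suc p) (excessRate-nonNeg (suc k ℕ.* toℕ (lookup c (suc zero))) (binomialSum c))

  upper : lookup c zero ≡ zero → ∀ z → IsCeiling (threshold n 2≤n 1≤k c) z →
    fromℚ (Σℤ (z ℤ.+ + M₁ ℤ.+ + 1) (+ n ℤ.+ + 1) P′) ≤ℝ exp ((ℤ.- + M₁) / 1)
  upper c₀ z (_ , hz) = go z (ceiling-nonNeg z (ℚ.≤-trans (rate-nonNeg c) bound)) bound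
    where
    bound = threshold-bound p k c 2≤n 1≤k z hz
    go : ∀ z → (∃ λ z′ → z ≡ + z′) → rate c ≤ z / 1 →
         fromℚ (Σℤ (z ℤ.+ + M₁ ℤ.+ + 1) (+ n ℤ.+ + 1) P′) ≤ℝ exp ((ℤ.- + M₁) / 1)
    -- The summation index m = M + 1 + i stands for the weight c_k + M + i; removing the first
    -- position leaves M + i ≥ z + M₁.
    go .(+ z) (z , refl) h = tail-bound (suc p) k c c c₀ z M₁
      ℤ.∣ (+ n ℤ.+ + 1 ℤ.- + (z ℕ.+ M₁ ℕ.+ 1)) ℤ.⊔ + 0 ∣ _ (cₖ ℕ.+ (z ℕ.+ M₁)) h
      (λ i → cong (λ l → + l ℤ.- + 1) (index z M₁ i cₖ))
      (λ σs i _ e → ℕ.≤-trans (ℕ.m≤m+n (z ℕ.+ M₁) i) (ℕ.≤-reflexive (sym (ℕ.+-cancelˡ-≡ cₖ _ _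
        (trans (sym (weight≡ c σs)) (trans e (ℕ.+-assoc cₖ (z ℕ.+ M₁) i)))))))
      where
      index : ∀ z m i c → z ℕ.+ m ℕ.+ 1 ℕ.+ i ℕ.+ c ≡ suc (c ℕ.+ (z ℕ.+ m) ℕ.+ i)
      index = solve-∀

  lower : lookup c zero ≡ suc zero → ∀ z → IsCeiling (threshold n 2≤n 1≤k (complement c)) z →
    fromℚ (Σℤ (+ 1) (+ n ℤ.+ + 1 ℤ.- (z ℤ.+ + M₁)) P′) ≤ℝ exp ((ℤ.- + M₁) / 1)
  lower c₀ z (_ , hz) = go z (ceiling-nonNeg z (ℚ.≤-trans (rate-nonNeg (complement c)) bound)) bound
    where
    bound = threshold-bound p k (complement c) 2≤n 1≤k z hz
    go : ∀ z → (∃ λ z′ → z ≡ + z′) → rate (complement c) ≤ z / 1 →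
         fromℚ (Σℤ (+ 1) (+ n ℤ.+ + 1 ℤ.- (z ℤ.+ + M₁)) P′) ≤ℝ exp ((ℤ.- + M₁) / 1)
    -- Here m = 1 + i stands for the weight c_k + i, so the complement selects n - 1 - i of the
    -- positions after the first. The strict bound m < n + 1 - M′ gives i + 1 + M′ ≤ n, which makes
    -- this at least M′.
    go .(+ z) (z , refl) h = tail-bound (suc p) k c (complement c)
      (trans (lookup-map zero Fin.opposite c) (cong Fin.opposite c₀)) z M₁
      ℤ.∣ (+ n ℤ.+ + 1 ℤ.- + (z ℕ.+ M₁) ℤ.- + 1) ℤ.⊔ + 0 ∣ _ cₖ h
      (λ i → cong (λ l → + suc l ℤ.- + 1) (ℕ.+-comm i cₖ))
      (λ σs i i<l e → ℕ.+-cancelˡ-≤ i _ _ (ℕ.≤-trans (ℕ.s≤s⁻¹ (room i i<l))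
        (ℕ.≤-reflexive (trans (sym (restWeight-complement c σs))
          (cong (ℕ._+ restWeight (complement c) σs) (ℕ.+-cancelˡ-≡ cₖ _ _ (trans (sym (weight≡ c σs)) e)))))))
      where
      room : ∀ i → i ℕ.< ℤ.∣ (+ n ℤ.+ + 1 ℤ.- + (z ℕ.+ M₁) ℤ.- + 1) ℤ.⊔ + 0 ∣ → suc i ℕ.+ (z ℕ.+ M₁) ℕ.≤ n
      room i i<l = ℤ.drop‿+≤+ (subst (+ (suc i ℕ.+ (z ℕ.+ M₁)) ℤ.≤_) (cancel (+ n) (+ (z ℕ.+ M₁)))
        (ℤ.+-monoˡ-≤ (+ (z ℕ.+ M₁)) (<∣⊔0∣ (+ n ℤ.+ + 1 ℤ.- + (z ℕ.+ M₁) ℤ.- + 1) i<l)))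
        where
        cancel : ∀ a b → a ℤ.+ + 1 ℤ.- b ℤ.- + 1 ℤ.+ b ≡ a
        cancel = ℤ-solve-∀
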